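{- Let $\mathbb{F}$ be a field, let $n,k\ge 1$ and $s\ge 2$ be integers, and let $C$ be a multi-$k$-ic algebraic circuit over $\mathbb{F}$ of size $s$ computing a polynomial in $n$ variables. Then there is a multi-$k$-ic $\Sigma\Pi\Sigma\Pi$ circuit $C'$ over $\mathbb{F}$ of size $$s^{O\left(\sqrt{\frac{kn}{\log s}}\right)}$$ computing the same polynomial. (The constant hidden in $O(\cdot)$ is absolute: it does not depend on $\mathbb{F}, n, k, s, C$.)
   Context: An algebraic circuit over a field $\mathbb{F}$ and variables $x_1,\dots,x_n$ is a directed acyclic graph whose internal vertices (gates) are labeled $+$ or $\times$ and whose leaves are labeled by variables or constants from $\mathbb{F}$; each gate computes the sum or product of the polynomials computed by its children, and the circuit computes the polynomial at its output gate. The size of a circuit is its number of edges. Fan-in is unbounded unless stated otherwise. A proof-tree rooted at a gate $u$ of a circuit is obtained by starting with $u$, including all children of every included $\times$ gate and exactly one child of every included $+$ gate, and unfolding the result into a tree. Each proof-tree computes a monomial (the product of its leaf labels); its $x_i$-degree is the number of leaves of the unfolded tree labeled $x_i$. For a gate $u$, $\mathrm{Var}(u)=(d_1,\dots,d_n)\in\mathbb{Z}_{\ge 0}^n$, where $d_i$ is the maximum $x_i$-degree over all proof-trees rooted at $u$. (Equivalently, $\mathrm{Var}(x_i)$ is the $i$-th unit vector, $\mathrm{Var}$ of a constant is $0$, $\mathrm{Var}$ of a $\times$ gate is the sum of the vectors of its children counted with multiplicity, and $\mathrm{Var}$ of a $+$ gate is the coordinate-wise maximum.) A circuit is multi-$k$-ic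 (syntactically) if $\mathrm{Var}(u)\in\{0,1,\dots,k\}^n$ for every gate $u$. A $\Sigma\Pi\Sigma\Pi$ circuit (depth-4 circuit) is a circuit with four layers of alternating sum and product gates of unbounded fan-in, the top (output) layer being a sum layer; inputs of gates in a layer are gates of the next layer below or leaves. $\log$ is to base 2. -}

module Defs where

open import Algebra.Apartness.Bundles using (HeytingField)
open import Data.Fin using (Fin; zero; suc)
open import Data.List using (List; []; _∷_; _++_; map; foldr; cartesianProductWith)
open import Data.List.Membership.Propositional using (_∈_)
open import Data.List.NonEmpty as List⁺ using (List⁺; toList)
open import Data.List.Relation.Unary.All using (All; []; _∷_)
open import Data.List.Relation.Unary.Any using (here; there)
open import Data.Nat using (ℕ; zero; suc; _+_; _*_; _^_; _⊔_; _≤_)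
open import Data.Nat.Properties
  using (_≟_; ≤-refl; ≤-reflexive; ≤-trans; +-mono-≤; m≤m⊔n; m≤n⊔m; ⊔-sel; ⊔-identityʳ)
open import Data.Product using (_×_; _,_; Σ-syntax; proj₁; proj₂)
open import Data.Sum using (_⊎_; inj₁; inj₂)
open import Data.Bool using (if_then_else_)
open import Data.Vec using (Vec; replicate; zipWith; lookup; _[_]≔_)
open import Data.Vec.Properties using (≡-dec; lookup-zipWith; lookup-replicate)
import Data.Vec.Relation.Unary.All as Vec
open import Function using (_∘_)
open import Level using (Level; Setω)
open import Relation.Binary.PropositionalEquality
  using (_≡_; refl; sym; trans; cong; cong₂; subst)
open import Relation.Nullary using (does)

-- Existential over a Setω-valued family: it lets a witness be chosen before
-- quantifying over all universe levels, hence independently of them.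
infixr 4 _,ω_
record ∃ω {A : Set} (B : A → Setω) : Setω where
  constructor _,ω_
  field
    witness  : A
    property : B witness

-- K √(m / log₂ s) ≤ p / q, for q ≥ 1: squaring and multiplying by q² log₂ s
-- turns this into K² m q² ≤ p² log₂ s; then exponentiate in base 2.
Exponent≤ : (K m s p q : ℕ) → Set
Exponent≤ K m s p q = 2 ^ (K * K * m * (q * q)) ≤ s ^ (p * p)

-- S ≤ s ^ (K √(m / log₂ s)), exactly.  As t ↦ s ^ t is continuous and
-- increasing, this says that S ≤ s ^ (p / q), i.e. S ^ q ≤ s ^ p, for every
-- nonnegative rational p / q that is at least the exponent.
Power≤ : (S s K m : ℕ) → Set
Power≤ S s K m = ∀ p q → 1 ≤ q → Exponent≤ K m s p q → S ^ q ≤ s ^ p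

module _ {n : ℕ} where

  𝟎 : Vec ℕ n
  𝟎 = replicate n 0

  unit : Fin n → Vec ℕ n
  unit i = 𝟎 [ i ]≔ 1

  infixl 6 _⊕_ _⊻_

  _⊕_ _⊻_ : Vec ℕ n → Vec ℕ n → Vec ℕ n
  _⊕_ = zipWith _+_
  _⊻_ = zipWith _⊔_

module _ {c ℓ₁ ℓ₂ : Level} (F : HeytingField c ℓ₁ ℓ₂) (n : ℕ) where

  private module F = HeytingField F

  -- A finite list of terms a · x₁^d₁ ⋯ xₙ^dₙ; exponents may be repeated and
  -- coefficients may vanish, so polynomials are compared by _≋_ below.
  Polynomial : Set c
  Polynomial = List (F.Carrier × Vec ℕ n)

  coeff : Polynomial → Vec ℕ n → F.Carrier
  coeff []            e = F.0#
  coeff ((a , d) ∷ p) e =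
    (if does (≡-dec _≟_ d e) then a else F.0#) F.+ coeff p e

  infix 4 _≋_
  _≋_ : Polynomial → Polynomial → Set ℓ₁
  p ≋ q = ∀ e → coeff p e F.≈ coeff q e

  constₚ : F.Carrier → Polynomial
  constₚ a = (a , 𝟎) ∷ []

  varₚ : Fin n → Polynomial
  varₚ i = (F.1# , unit i) ∷ []

  _+ₚ_ _*ₚ_ : Polynomial → Polynomial → Polynomial
  p +ₚ q = p ++ q
  p *ₚ q = cartesianProductWith (λ (a , d) (b , e) → (a F.* b , d ⊕ e)) p q

  -- A vertex whose children are among N given ones.  Children form a list, so
  -- parallel edges are allowed.
  data Vertex (N : ℕ) : Set c where
    var     : Fin n → Vertex N
    const   : F.Carrier → Vertex N
    add mul : List⁺ (Fin N) → Vertex N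

  -- Finite directed acyclic graphs, listed in a topological order: the children
  -- of each vertex occur before it.  Every finite DAG admits such an order.
  -- In G ▷ g the new vertex g is zero, and the vertex u of G is suc u.
  infixl 5 _▷_
  data DAG : ℕ → Set c where
    []  : DAG 0
    _▷_ : ∀ {N} → DAG N → Vertex N → DAG (suc N)

  record Circuit : Set c where
    constructor circuit
    field
      {order} : ℕ
      graph   : DAG order
      output  : Fin order

  open Circuit public

  renameVertex : ∀ {M N} → (Fin M → Fin N) → Vertex M → Vertex N
  renameVertex f (var i)   = var i
  renameVertex f (const a) = const a
  renameVertex f (add vs)  = add (List⁺.map f vs)
  renameVertex f (mul vs)  = mul (List⁺.map f vs)

  vertex : ∀ {N} → DAG N → Fin N → Vertex N
  vertex (G ▷ g) zero    = renameVertex suc g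
  vertex (G ▷ g) (suc u) = renameVertex suc (vertex G u)

  fanIn : ∀ {N} → Vertex N → ℕ
  fanIn (var _)   = 0
  fanIn (const _) = 0
  fanIn (add vs)  = List⁺.length vs
  fanIn (mul vs)  = List⁺.length vs

  edges : ∀ {N} → DAG N → ℕ
  edges []      = 0
  edges (G ▷ g) = edges G + fanIn g

  size : Circuit → ℕ
  size C = edges (graph C)

  vertexPoly : ∀ {N} → (Fin N → Polynomial) → Vertex N → Polynomial
  vertexPoly P (var i)   = varₚ i
  vertexPoly P (const a) = constₚ a
  vertexPoly P (add vs)  = foldr _+ₚ_ [] (map P (toList vs))
  vertexPoly P (mul vs)  = foldr _*ₚ_ (constₚ F.1#) (map P (toList vs))

  poly : ∀ {N} → DAG N → Fin N → Polynomial
  poly (G ▷ g) zero    = vertexPoly (poly G) g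
  poly (G ▷ g) (suc u) = poly G u

  computed : Circuit → Polynomial
  computed C = poly (graph C) (output C)

  -- Var by recursion on the circuit; Var-max below shows that it is the maximum
  -- of the degrees of proof-trees.
  vertexVar : ∀ {N} → (Fin N → Vec ℕ n) → Vertex N → Vec ℕ n
  vertexVar V (var i)   = unit i
  vertexVar V (const _) = 𝟎
  vertexVar V (add vs)  = foldr _⊻_ 𝟎 (map V (toList vs))
  vertexVar V (mul vs)  = foldr _⊕_ 𝟎 (map V (toList vs))

  Var : ∀ {N} → DAG N → Fin N → Vec ℕ n
  Var (G ▷ g) zero    = vertexVar (Var G) g
  Var (G ▷ g) (suc u) = Var G u

  Multi-ic : ℕ → Circuit → Set
  Multi-ic k C = ∀ u → Vec.All (_≤ k) (Var (graph C) u)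

  -- Proof-trees are unfolded, so copies of a shared + gate may choose different
  -- children.  Making the same choice in all copies gives the same maxima: the
  -- best child for the i-th coordinate does not depend on the copy.
  data VertexTree {N} (T : Fin N → Set c) : Vertex N → Set c where
    var   : ∀ i → VertexTree T (var i)
    const : ∀ a → VertexTree T (const a)
    add   : ∀ {vs v} → v ∈ toList vs → T v → VertexTree T (add vs)
    mul   : ∀ {vs} → All T (toList vs) → VertexTree T (mul vs)

  ProofTree : ∀ {N} → DAG N → Fin N → Set c
  ProofTree (G ▷ g) zero    = VertexTree (ProofTree G) g
  ProofTree (G ▷ g) (suc u) = ProofTree G u

  module _ {N} {T : Fin N → Set c} (deg : ∀ v → T v → Vec ℕ n) where

    sumDegree : ∀ {vs} → All T vs → Vec ℕ n
    sumDegree []             = 𝟎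
    sumDegree (_∷_ {v} t ts) = deg v t ⊕ sumDegree ts

    vertexDegree : ∀ {g} → VertexTree T g → Vec ℕ n
    vertexDegree (var i)         = unit i
    vertexDegree (const _)       = 𝟎
    vertexDegree (add {v = v} _ t) = deg v t
    vertexDegree (mul ts)        = sumDegree ts

  -- The i-th coordinate counts the leaves labelled by the i-th variable.
  degree : ∀ {N} (G : DAG N) u → ProofTree G u → Vec ℕ n
  degree (G ▷ g) zero    t = vertexDegree (degree G) t
  degree (G ▷ g) (suc u) t = degree G u t

  -- d is the maximal x_i-degree over the trees in T
  IsMaxDegree : {T : Set c} → (T → Vec ℕ n) → Fin n → ℕ → Set c
  IsMaxDegree {T} deg i d =
    (∀ t → lookup (deg t) i ≤ d) × (Σ[ t ∈ T ] lookup (deg t) i ≡ d)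

  private
    module _ {N} {T : Fin N → Set c} (deg : ∀ v → T v → Vec ℕ n)
             (V : Fin N → Vec ℕ n) (i : Fin n)
             (ih : ∀ v → IsMaxDegree (deg v) i (lookup (V v) i)) where

      ⨁ ⨆ : List (Fin N) → ℕ
      ⨁ vs = lookup (foldr _⊕_ 𝟎 (map V vs)) i
      ⨆ vs = lookup (foldr _⊻_ 𝟎 (map V vs)) i

      ⊕-at : ∀ x y → lookup (x ⊕ y) i ≡ lookup x i + lookup y i
      ⊕-at = lookup-zipWith _+_ i

      ⊻-at : ∀ x y → lookup (x ⊻ y) i ≡ lookup x i ⊔ lookup y i
      ⊻-at = lookup-zipWith _⊔_ i

      ∈⇒≤⨆ : ∀ {v} vs → v ∈ vs → lookup (V v) i ≤ ⨆ vs
      ∈⇒≤⨆ (v ∷ vs) (here refl) = subst (lookup (V v) i ≤_)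
        (sym (⊻-at (V v) _)) (m≤m⊔n _ (⨆ vs))
      ∈⇒≤⨆ (v ∷ vs) (there v∈)  = subst (lookup (V _) i ≤_)
        (sym (⊻-at (V v) _)) (≤-trans (∈⇒≤⨆ vs v∈) (m≤n⊔m _ _))

      attained : ∀ v vs → Σ[ w ∈ Fin N ] (w ∈ (v ∷ vs)) × lookup (V w) i ≡ ⨆ (v ∷ vs)
      attained v [] = v , here refl ,
        sym (trans (⊻-at (V v) 𝟎) (trans (cong (lookup (V v) i ⊔_) 𝟎-at) (⊔-identityʳ _)))
        where
        𝟎-at : lookup 𝟎 i ≡ 0
        𝟎-at = lookup-replicate i 0
      attained v (v′ ∷ vs) with attained v′ vs | ⊔-sel (lookup (V v) i) (⨆ (v′ ∷ vs))
      ... | _ | inj₁ eq = v , here refl , sym (trans (⊻-at (V v) _) eq)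
      ... | w , w∈ , w≡ | inj₂ eq = w , there w∈ , trans w≡ (sym (trans (⊻-at (V v) _) eq))

      sum-≤ : ∀ {vs} (ts : All T vs) → lookup (sumDegree deg ts) i ≤ ⨁ vs
      sum-≤ [] = ≤-refl
      sum-≤ (_∷_ {v} t ts) = ≤-trans (≤-reflexive (⊕-at (deg v t) _))
        (≤-trans (+-mono-≤ (proj₁ (ih v) t) (sum-≤ ts)) (≤-reflexive (sym (⊕-at (V v) _))))

      sum-attained : ∀ vs → Σ[ ts ∈ All T vs ] lookup (sumDegree deg ts) i ≡ ⨁ vs
      sum-attained [] = [] , refl
      sum-attained (v ∷ vs) with proj₂ (ih v) | sum-attained vs
      ... | t , t≡ | ts , ts≡ = t ∷ ts ,
        trans (⊕-at (deg v t) _) (trans (cong₂ _+_ t≡ ts≡) (sym (⊕-at (V v) _)))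

      vertex-max : ∀ g → IsMaxDegree (vertexDegree deg {g}) i (lookup (vertexVar V g) i)
      vertex-max (var j)   = (λ { (var _) → ≤-refl }) , var j , refl
      vertex-max (const a) = (λ { (const _) → ≤-refl }) , const a , refl
      vertex-max (add vs)  =
        (λ { (add {v = v} v∈ t) → ≤-trans (proj₁ (ih v) t) (∈⇒≤⨆ (toList vs) v∈) }) ,
        maximal
        where
        maximal : Σ[ t ∈ VertexTree T (add vs) ]
                  lookup (vertexDegree deg t) i ≡ ⨆ (toList vs)
        maximal with attained (List⁺.head vs) (List⁺.tail vs)
        ... | w , w∈ , w≡ with proj₂ (ih w)
        ...   | t , t≡ = add w∈ t , trans t≡ w≡
      vertex-max (mul vs)  = (λ { (mul ts) → sum-≤ ts }) ,
        mul (proj₁ (sum-attained (toList vs))) , proj₂ (sum-attained (toList vs))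

  Var-max : ∀ {N} (G : DAG N) u i → IsMaxDegree (degree G u) i (lookup (Var G u) i)
  Var-max (G ▷ g) zero    i =
    vertex-max (degree G) (Var G) i (λ v → Var-max G v i) g
  Var-max (G ▷ g) (suc u) i = Var-max G u i

  data Layer : Set where
    topΣ upperΠ lowerΣ bottomΠ : Layer

  data IsΣ : Layer → Set where
    topΣ   : IsΣ topΣ
    lowerΣ : IsΣ lowerΣ

  data IsΠ : Layer → Set where
    upperΠ  : IsΠ upperΠ
    bottomΠ : IsΠ bottomΠ

  -- l ⋗ m: the layer m is the next one below l
  infix 4 _⋗_
  data _⋗_ : Layer → Layer → Set where
    topΣ⋗upperΠ    : topΣ ⋗ upperΠ
    upperΠ⋗lowerΣ  : upperΠ ⋗ lowerΣ
    lowerΣ⋗bottomΠ : lowerΣ ⋗ bottomΠ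

  data IsLeaf {N} : Vertex N → Set c where
    var   : ∀ i → IsLeaf (var i)
    const : ∀ a → IsLeaf (const a)

  data IsSum {N} : Vertex N → Set c where
    add : ∀ vs → IsSum (add vs)

  module _ {N} (G : DAG N) (layer : Fin N → Layer) where

    Input : Layer → Fin N → Set c
    Input l v = IsLeaf (vertex G v) ⊎ l ⋗ layer v

    -- The layer assigned to a leaf is irrelevant.
    data WellPlaced (l : Layer) : Vertex N → Set c where
      var   : ∀ i → WellPlaced l (var i)
      const : ∀ a → WellPlaced l (const a)
      add   : ∀ {vs} → IsΣ l → All (Input l) (toList vs) → WellPlaced l (add vs)
      mul   : ∀ {vs} → IsΠ l → All (Input l) (toList vs) → WellPlaced l (mul vs)

  record IsΣΠΣΠ (C : Circuit) : Set c where
    field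
      layer      : Fin (order C) → Layer
      wellPlaced : ∀ u → WellPlaced (graph C) layer (layer u) (vertex (graph C) u)
      outputSum  : IsSum (vertex (graph C) (output C))
      outputTop  : layer (output C) ≡ topΣ

{-# OPTIONS --safe #-}
module Submission where

-- Make the circuit binary and let w(u) be the sum of the coordinates of Var(u),
-- so w ≤ kn.  Fix t.  From a gate u with w(u) > t walk down, into the heavier
-- factor of each product, until the weight has dropped by t.  Merging the walks
-- by the last gate v they visit above that threshold gives f_u = Σ_v [u : v] r_v.
-- Here [u : v] has exponents ≼ Var(u) - Var(v), of total degree less than t, and
-- r_v is made of the polynomials of gates of weight ≤ w(u) - t: a child of v if v
-- is a sum gate, the product of both children if v is a product gate (the lighter
-- child is at most as heavy as the other).  Iterating until w ≤ t costs O(kn/t)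
-- cuts with at most 2s choices each, so f is a sum of s^O(kn/t) products of
-- O(kn/t) polynomials, each with at most 2^t monomials.  As exponent vectors
-- only ever add up to at most Var(u), the result stays multi-k-ic.  The choice
-- t ≈ √(kn log s) balances both factors.

open import Defs
open import Algebra.Apartness.Bundles using (HeytingCommutativeRing; HeytingField)
open import Algebra.Bundles using (CommutativeRing; CommutativeSemiring)
open import Algebra.Structures.Biased using (IsCommutativeMonoidˡ; IsCommutativeSemiringˡ)
open import Data.Bool using (if_then_else_)
open import Data.Fin using (Fin; zero; suc)
open import Data.List
  using (List; []; _∷_; _++_; map; foldr; length; cartesianProductWith; upTo; replicate)
open import Data.List.Membership.Propositional using (_∈_; _∉_)
open import Data.List.Membership.Propositional.Properties
  using (∈-upTo⁺; ∈-upTo⁻; ∈-cartesianProductWith⁺; ∈-cartesianProductWith⁻)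
open import Data.List.NonEmpty using (_∷_)
open import Data.List.Properties using (++-assoc; length-++; length-map; length-upTo; map-∘; map-cong)
open import Data.List.Relation.Unary.All as All using (All; []; _∷_)
import Data.List.Relation.Unary.All.Properties as All
open import Data.List.Relation.Unary.Any using (here; there)
open import Data.List.Relation.Unary.Unique.Propositional using (Unique; []; _∷_)
import Data.List.Relation.Unary.Unique.Propositional.Properties as Unique
open import Data.Nat
  using (ℕ; zero; suc; _+_; _*_; _∸_; _^_; _/_; _≤_; _<_; _≤?_; _<?_; z≤n; s≤s; s≤s⁻¹; NonZero; >-nonZero)
import Data.Nat.DivMod as ℕ
open import Data.Nat.Properties as ℕ using (_≟_)
open import Data.Nat.Tactic.RingSolver using (solve-∀)
open import Data.Product using (_×_; _,_; Σ-syntax; ∃)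
open import Data.Sum as Sum using (_⊎_; inj₁; inj₂)
open import Data.Vec as Vec using (Vec; []; _∷_; zipWith)
open import Data.Vec.Functional using (Vector)
open import Data.Vec.Properties as Vec using (≡-dec)
open import Data.Vec.Relation.Binary.Pointwise.Inductive as Pointwise using (Pointwise; []; _∷_)
import Data.Vec.Relation.Unary.All as Vec using (All; []; _∷_)
open import Function using (_∘_; id; case_of_)
open import Level using (_⊔_) renaming (suc to lsuc)
open import Relation.Binary.PropositionalEquality as ≡ using (_≡_; refl; cong; cong₂; subst; subst₂)
open import Relation.Binary.Structures using (IsEquivalence)
open import Relation.Nullary using (¬_; Dec; yes; no; does; contradiction)

-- When a walk leaves through a product gate, the factors have weights `a` and `b`, both at most
-- `w - t`, but `a + b` may still equal `w`. The total weight then does not drop, so no constant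
-- multiple of `w / t` can pay for the cut. The affine potential `2 * w - t`, set to zero for
-- `w ≤ t`, can: two surviving factors subtract `t` twice, the parent only once. Being multi-k-ic is
-- a property of a circuit and not of its polynomials, so a bound on the exponents of a path
-- polynomial says nothing yet about `Var` in the new circuit. Every piece therefore carries a
-- declared bound and is rewritten as a sum over all monomials below it, which turns the bound on
-- exponents into a bound on `Var`. Monomials with vanishing coefficient are kept, since equality
-- with zero need not be decidable in a Heyting field. A walk must leave the heavy region through a
-- gate and not end in a leaf; this holds because leaves have weight at most 1 and the threshold
-- `w - t` is positive.

-- Exponent vectors: order, truncated subtraction, weight

infix 4 _≼_ _≼?_
_≼_ : ∀ {n} → Vec ℕ n → Vec ℕ n → Set
_≼_ = Pointwise _≤_

_≼?_ : ∀ {n} (x y : Vec ℕ n) → Dec (x ≼ y)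
_≼?_ = Pointwise.decidable ℕ._≤?_

≼-refl : ∀ {n} {x : Vec ℕ n} → x ≼ x
≼-refl = Pointwise.refl ℕ.≤-refl

≼-reflexive : ∀ {n} {x y : Vec ℕ n} → x ≡ y → x ≼ y
≼-reflexive refl = ≼-refl

≼-trans : ∀ {n} {x y z : Vec ℕ n} → x ≼ y → y ≼ z → x ≼ z
≼-trans = Pointwise.trans ℕ.≤-trans

𝟎≼ : ∀ {n} (x : Vec ℕ n) → 𝟎 ≼ x
𝟎≼ []      = []
𝟎≼ (_ ∷ x) = z≤n ∷ 𝟎≼ x

⊕-mono-≼ : ∀ {n} {x x′ y y′ : Vec ℕ n} → x ≼ x′ → y ≼ y′ → x ⊕ y ≼ x′ ⊕ y′
⊕-mono-≼ []       []       = []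
⊕-mono-≼ (p ∷ ps) (q ∷ qs) = ℕ.+-mono-≤ p q ∷ ⊕-mono-≼ ps qs

x≼x⊻y : ∀ {n} (x y : Vec ℕ n) → x ≼ x ⊻ y
x≼x⊻y []      []      = []
x≼x⊻y (a ∷ x) (b ∷ y) = ℕ.m≤m⊔n a b ∷ x≼x⊻y x y

y≼x⊻y : ∀ {n} (x y : Vec ℕ n) → y ≼ x ⊻ y
y≼x⊻y []      []      = []
y≼x⊻y (a ∷ x) (b ∷ y) = ℕ.m≤n⊔m a b ∷ y≼x⊻y x y

⊻-lub : ∀ {n} {x y z : Vec ℕ n} → x ≼ z → y ≼ z → x ⊻ y ≼ z
⊻-lub []       []       = []
⊻-lub (p ∷ ps) (q ∷ qs) = ℕ.⊔-lub p q ∷ ⊻-lub ps qs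

x≼x⊕y : ∀ {n} (x y : Vec ℕ n) → x ≼ x ⊕ y
x≼x⊕y []      []      = []
x≼x⊕y (a ∷ x) (b ∷ y) = ℕ.m≤m+n a b ∷ x≼x⊕y x y

y≼x⊕y : ∀ {n} (x y : Vec ℕ n) → y ≼ x ⊕ y
y≼x⊕y []      []      = []
y≼x⊕y (a ∷ x) (b ∷ y) = ℕ.m≤n+m b a ∷ y≼x⊕y x y

⊕-comm : ∀ {n} (x y : Vec ℕ n) → x ⊕ y ≡ y ⊕ x
⊕-comm = Vec.zipWith-comm ℕ.+-comm

⊕-assoc : ∀ {n} (x y z : Vec ℕ n) → (x ⊕ y) ⊕ z ≡ x ⊕ (y ⊕ z)
⊕-assoc = Vec.zipWith-assoc ℕ.+-assoc

⊕-identityˡ : ∀ {n} (x : Vec ℕ n) → 𝟎 ⊕ x ≡ x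
⊕-identityˡ = Vec.zipWith-identityˡ ℕ.+-identityˡ

⊕-cancelˡ : ∀ {n} (x : Vec ℕ n) {y z} → x ⊕ y ≡ x ⊕ z → y ≡ z
⊕-cancelˡ []      {[]}    {[]}    _  = refl
⊕-cancelˡ (a ∷ x) {_ ∷ _} {_ ∷ _} eq =
  cong₂ _∷_ (ℕ.+-cancelˡ-≡ a _ _ (Vec.∷-injectiveˡ eq)) (⊕-cancelˡ x (Vec.∷-injectiveʳ eq))

infixl 6 _⊖_
_⊖_ : ∀ {n} → Vec ℕ n → Vec ℕ n → Vec ℕ n
_⊖_ = zipWith _∸_

⊖-⊕ : ∀ {n} {x y : Vec ℕ n} → y ≼ x → (x ⊖ y) ⊕ y ≡ x
⊖-⊕ []       = refl
⊖-⊕ (p ∷ ps) = cong₂ _∷_ (ℕ.m∸n+n≡m p) (⊖-⊕ ps)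

⊕≼⇒≼⊖ : ∀ {n} (d : Vec ℕ n) {x y} → d ⊕ y ≼ x → d ≼ x ⊖ y
⊕≼⇒≼⊖ []      {[]}    {[]}    []       = []
⊕≼⇒≼⊖ (a ∷ d) {_ ∷ _} {b ∷ _} (p ∷ ps) = ℕ.m+n≤o⇒m≤o∸n a p ∷ ⊕≼⇒≼⊖ d ps

weight : ∀ {n} → Vec ℕ n → ℕ
weight = Vec.sum

weight-mono : ∀ {n} {x y : Vec ℕ n} → x ≼ y → weight x ≤ weight y
weight-mono []       = ℕ.≤-refl
weight-mono (p ∷ ps) = ℕ.+-mono-≤ p (weight-mono ps)

weight-⊕ : ∀ {n} (x y : Vec ℕ n) → weight (x ⊕ y) ≡ weight x + weight y
weight-⊕ []      []      = refl
weight-⊕ (a ∷ x) (b ∷ y) = ≡.trans (cong ((a + b) +_) (weight-⊕ x y)) (interchange a b (weight x) (weight y))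
  where open import Algebra.Properties.CommutativeSemigroup ℕ.+-commutativeSemigroup using (interchange)

weight-⊖-≤ : ∀ {n t} {x y : Vec ℕ n} → y ≼ x → weight x ≤ t + weight y → weight (x ⊖ y) ≤ t
weight-⊖-≤ {t = t} {x} {y} y≼x x≤ = ℕ.+-cancelʳ-≤ (weight y) _ t
  (ℕ.≤-trans (ℕ.≤-reflexive (≡.trans (≡.sym (weight-⊕ (x ⊖ y) y)) (cong weight (⊖-⊕ y≼x)))) x≤)

weight-𝟎 : ∀ n → weight (𝟎 {n}) ≡ 0
weight-𝟎 zero    = refl
weight-𝟎 (suc n) = weight-𝟎 n

weight-unit : ∀ {n} (i : Fin n) → weight (unit i) ≡ 1
weight-unit {suc n} zero    = cong suc (weight-𝟎 n)
weight-unit {suc n} (suc i) = weight-unit i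

weight-bounded : ∀ {n k} {x : Vec ℕ n} → Vec.All (_≤ k) x → weight x ≤ k * n
weight-bounded {n} {k} {x} ps = subst (weight x ≤_) (ℕ.*-comm n k) (go ps)
  where
  go : ∀ {n} {x : Vec ℕ n} → Vec.All (_≤ k) x → weight x ≤ n * k
  go Vec.[]         = z≤n
  go (p Vec.∷ ps) = ℕ.+-mono-≤ p (go ps)

All-≼ : ∀ {n k} {x y : Vec ℕ n} → x ≼ y → Vec.All (_≤ k) y → Vec.All (_≤ k) x
All-≼ []       Vec.[]       = Vec.[]
All-≼ (p ∷ ps) (q Vec.∷ qs) = ℕ.≤-trans p q Vec.∷ All-≼ ps qs

complement? : ∀ {n} (d e : Vec ℕ n) → Dec (∃ λ r → d ⊕ r ≡ e)
complement? d e with d ≼? e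
... | yes d≼e = yes (e ⊖ d , ≡.trans (⊕-comm d (e ⊖ d)) (⊖-⊕ d≼e))
... | no d⋠e  = no λ (r , eq) → d⋠e (subst (d ≼_) eq (x≼x⊕y d r))

length-cartesianProductWith : ∀ {a b c} {A : Set a} {B : Set b} {C : Set c} (f : A → B → C) xs ys →
  length (cartesianProductWith f xs ys) ≡ length xs * length ys
length-cartesianProductWith f []       ys = refl
length-cartesianProductWith f (x ∷ xs) ys = ≡.trans (length-++ (map (f x) ys))
  (cong₂ _+_ (length-map (f x) ys) (length-cartesianProductWith f xs ys))

-- With if_then_else_ the decision would unfold to _≤ᵇ_, beyond the reach of
-- with-abstraction on the decision itself.
infix 0 if?_then_else_
if?_then_else_ : ∀ {a p} {A : Set a} {P : Set p} → Dec P → A → A → A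
if? yes _ then x else y = x
if? no _  then x else y = y

-- A potential that counts the cuts

module _ (t : ℕ) .{{_ : NonZero t}} where
  -- budget w bounds the number of cuts below a gate of weight w; it is the
  -- quotient by t of a function for which budget-split holds.
  slack : ℕ → ℕ
  slack w = if? t <? w then 2 * w ∸ t else 0

  budget : ℕ → ℕ
  budget w = slack w / t

  budget*t≤slack : ∀ w → budget w * t ≤ slack w
  budget*t≤slack w = ℕ.m/n*n≤m (slack w) t

  slack≤ : ∀ w → slack w ≤ 2 * w
  slack≤ w with t <? w
  ... | yes _ = ℕ.m∸n≤m (2 * w) t
  ... | no _  = z≤n

  budget-small : ∀ {w} → w ≤ t → budget w ≡ 0
  budget-small {w} w≤t with t <? w
  ... | yes t<w = contradiction t<w (ℕ.≤⇒≯ w≤t)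
  ... | no _    = ℕ.0/n≡0 t

  -- Each case has its own source for the two copies of `t`. If at most one part is heavier than
  -- `t`, the drop of a single part by `t` suffices; if both are, each slack already lacks a `t`,
  -- and `a + b ≤ w` remains to be used.
  slack-split : ∀ {w a b} → a + t ≤ w → b + t ≤ w → a + b ≤ w → t + (t + (slack a + slack b)) ≤ 2 * w
  slack-split {w} {a} {b} at≤w bt≤w ab≤w with t <? a | t <? b
  ... | no _ | no _ = ℕ.≤-trans (ℕ.≤-reflexive (double t)) (ℕ.*-monoʳ-≤ 2 (ℕ.≤-trans (ℕ.m≤n+m t a) at≤w))
    where
    double : ∀ t → t + (t + 0) ≡ 2 * t
    double = solve-∀
  ... | yes _ | no _ = begin
    t + (t + ((2 * a ∸ t) + 0))  ≤⟨ ℕ.+-monoʳ-≤ t (ℕ.+-monoʳ-≤ t (ℕ.+-monoˡ-≤ 0 (ℕ.m∸n≤m (2 * a) t))) ⟩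
    t + (t + (2 * a + 0))        ≡⟨ double t a ⟩
    2 * (a + t)                  ≤⟨ ℕ.*-monoʳ-≤ 2 at≤w ⟩
    2 * w                        ∎
    where
    open ℕ.≤-Reasoning
    double : ∀ t a → t + (t + (2 * a + 0)) ≡ 2 * (a + t)
    double = solve-∀
  ... | no _ | yes _ = begin
    t + (t + (2 * b ∸ t))  ≤⟨ ℕ.+-monoʳ-≤ t (ℕ.+-monoʳ-≤ t (ℕ.m∸n≤m (2 * b) t)) ⟩
    t + (t + 2 * b)        ≡⟨ double t b ⟩
    2 * (b + t)            ≤⟨ ℕ.*-monoʳ-≤ 2 bt≤w ⟩
    2 * w                  ∎
    where
    open ℕ.≤-Reasoning
    double : ∀ t b → t + (t + 2 * b) ≡ 2 * (b + t)
    double = solve-∀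
  ... | yes t<a | yes t<b = begin
    t + (t + ((2 * a ∸ t) + (2 * b ∸ t)))    ≡⟨ regroup t (2 * a ∸ t) (2 * b ∸ t) ⟩
    ((2 * a ∸ t) + t) + ((2 * b ∸ t) + t)    ≡⟨ cong₂ _+_ (ℕ.m∸n+n≡m (t≤2* t<a)) (ℕ.m∸n+n≡m (t≤2* t<b)) ⟩
    2 * a + 2 * b                            ≡⟨ ℕ.*-distribˡ-+ 2 a b ⟨
    2 * (a + b)                              ≤⟨ ℕ.*-monoʳ-≤ 2 ab≤w ⟩
    2 * w                                    ∎
    where
    open ℕ.≤-Reasoning
    regroup : ∀ t x y → t + (t + (x + y)) ≡ (x + t) + (y + t)
    regroup = solve-∀
    t≤2* : ∀ {x} → t < x → t ≤ 2 * x
    t≤2* t<x = ℕ.≤-trans (ℕ.<⇒≤ t<x) (ℕ.m≤n*m _ 2)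

  -- One unit of budget pays for the cut itself. Rounding loses nothing: the left side is an integer
  -- whose multiple by `t` is at most `slack w`, so it survives division by `t`.
  budget-split : ∀ {w a b} → t < w → a + t ≤ w → b + t ≤ w → a + b ≤ w →
    suc (budget a + budget b) ≤ budget w
  budget-split {w} {a} {b} t<w at≤w bt≤w ab≤w = begin
    suc (budget a + budget b)               ≡⟨ ℕ.m*n/n≡m (suc (budget a + budget b)) t ⟨
    suc (budget a + budget b) * t / t       ≤⟨ ℕ./-monoˡ-≤ t bound ⟩
    slack w / t                             ∎
    where
    open ℕ.≤-Reasoning
    large : slack w ≡ 2 * w ∸ t
    large with t <? w
    ... | yes _  = refl
    ... | no t≮w = contradiction t<w t≮w
    bound : suc (budget a + budget b) * t ≤ slack w
    bound = begin
      t + (budget a + budget b) * t        ≡⟨ cong (t +_) (ℕ.*-distribʳ-+ t (budget a) (budget b)) ⟩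
      t + (budget a * t + budget b * t)    ≤⟨ ℕ.+-monoʳ-≤ t (ℕ.+-mono-≤ (budget*t≤slack a) (budget*t≤slack b)) ⟩
      t + (slack a + slack b)              ≤⟨ ℕ.m+n≤o⇒m≤o∸n _ (ℕ.≤-trans (ℕ.≤-reflexive (ℕ.+-comm _ t))
                                                  (slack-split {w} {a} {b} at≤w bt≤w ab≤w)) ⟩
      2 * w ∸ t                            ≡⟨ large ⟨
      slack w                              ∎

-- Commutative semirings with degree bounds

record DegreeFiltration {c ℓ} (R : CommutativeSemiring c ℓ) (n : ℕ) : Set (lsuc (c ⊔ ℓ)) where
  open CommutativeSemiring R renaming (_+_ to _+ᴿ_; _*_ to _*ᴿ_)
  infix 4 _⊑_
  field
    -- p ⊑ D: all exponent vectors of p are ≼ D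
    _⊑_    : Carrier → Vec ℕ n → Set (c ⊔ ℓ)
    1#-⊑   : 1# ⊑ 𝟎
    +-⊑    : ∀ {p q D} → p ⊑ D → q ⊑ D → p +ᴿ q ⊑ D
    *-⊑    : ∀ {p q D E} → p ⊑ D → q ⊑ E → p *ᴿ q ⊑ D ⊕ E
    ⊑-resp : ∀ {p q D} → p ≈ q → p ⊑ D → q ⊑ D
    ⊑-mono : ∀ {p D E} → D ≼ E → p ⊑ D → p ⊑ E

-- Binary circuits and their heavy paths

module Expansions {c ℓ} {R : CommutativeSemiring c ℓ} {n : ℕ} (filtration : DegreeFiltration R n) where
  open CommutativeSemiring R renaming
    ( _+_ to _+ᴿ_; _*_ to _*ᴿ_; refl to ≈-refl; sym to ≈-sym; trans to ≈-trans
    ; zero to zeroᴿ )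
  open DegreeFiltration filtration
  open import Algebra.Properties.Semiring.Sum semiring
    using (sum; sum-cong-≋; ∑-distrib-+; *-distribʳ-sum; sum-replicate-zero)
  open import Algebra.Properties.CommutativeSemigroup *-commutativeSemigroup using (xy∙z≈xz∙y)
  open import Relation.Binary.Reasoning.Setoid setoid

  -- Circuits of fan-in two whose leaves are part of the operands, so that M is
  -- exactly the number of edges of the circuit they come from.
  record Atom : Set (c ⊔ ℓ) where
    field
      value    : Carrier
      bound    : Vec ℕ n
      value⊑   : value ⊑ bound
      weight≤1 : weight bound ≤ 1
  open Atom

  data Operand (M : ℕ) : Set (c ⊔ ℓ) where
    atom : Atom → Operand M
    gate : Fin M → Operand M

  data Node (M : ℕ) : Set (c ⊔ ℓ) where
    add mul : Operand M → Operand M → Node M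

  data Gates : ℕ → Set (c ⊔ ℓ) where
    []  : Gates 0
    _▸_ : ∀ {M} → Gates M → Node M → Gates (suc M)

  val  : ∀ {M} → Gates M → Fin M → Carrier
  valᵒ : ∀ {M} → Gates M → Operand M → Carrier
  valⁿ : ∀ {M} → Gates M → Node M → Carrier
  val (G ▸ g) zero    = valⁿ G g
  val (G ▸ g) (suc u) = val G u
  valᵒ G (atom a) = value a
  valᵒ G (gate u) = val G u
  valⁿ G (add x y) = valᵒ G x +ᴿ valᵒ G y
  valⁿ G (mul x y) = valᵒ G x *ᴿ valᵒ G y

  deg  : ∀ {M} → Gates M → Fin M → Vec ℕ n
  degᵒ : ∀ {M} → Gates M → Operand M → Vec ℕ n
  degⁿ : ∀ {M} → Gates M → Node M → Vec ℕ n
  deg (G ▸ g) zero    = degⁿ G g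
  deg (G ▸ g) (suc u) = deg G u
  degᵒ G (atom a) = bound a
  degᵒ G (gate u) = deg G u
  degⁿ G (add x y) = degᵒ G x ⊻ degᵒ G y
  degⁿ G (mul x y) = degᵒ G x ⊕ degᵒ G y

  val⊑  : ∀ {M} (G : Gates M) u → val G u ⊑ deg G u
  valᵒ⊑ : ∀ {M} (G : Gates M) x → valᵒ G x ⊑ degᵒ G x
  val⊑ (G ▸ add x y) zero = +-⊑ (⊑-mono (x≼x⊻y _ _) (valᵒ⊑ G x)) (⊑-mono (y≼x⊻y _ _) (valᵒ⊑ G y))
  val⊑ (G ▸ mul x y) zero = *-⊑ (valᵒ⊑ G x) (valᵒ⊑ G y)
  val⊑ (G ▸ g) (suc u) = val⊑ G u
  valᵒ⊑ G (atom a) = value⊑ a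
  valᵒ⊑ G (gate u) = val⊑ G u

  module _ {M} (G : Gates M) where
    weightᵒ : Operand M → ℕ
    weightᵒ x = weight (degᵒ G x)

    heavy light : Operand M → Operand M → Operand M
    heavy x y = if? weightᵒ y ≤? weightᵒ x then x else y
    light x y = if? weightᵒ y ≤? weightᵒ x then y else x

    heavy*light : ∀ x y → valᵒ G (heavy x y) *ᴿ valᵒ G (light x y) ≈ valᵒ G x *ᴿ valᵒ G y
    heavy*light x y with weightᵒ y ≤? weightᵒ x
    ... | yes _ = ≈-refl
    ... | no _  = *-comm _ _

    heavy⊕light : ∀ x y → degᵒ G (heavy x y) ⊕ degᵒ G (light x y) ≡ degᵒ G x ⊕ degᵒ G y
    heavy⊕light x y with weightᵒ y ≤? weightᵒ x
    ... | yes _ = refl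
    ... | no _  = ⊕-comm (degᵒ G y) (degᵒ G x)

    light≤heavy : ∀ x y → weightᵒ (light x y) ≤ weightᵒ (heavy x y)
    light≤heavy x y with weightᵒ y ≤? weightᵒ x
    ... | yes y≤x = y≤x
    ... | no y≰x  = ℕ.<⇒≤ (ℕ.≰⇒> y≰x)

  -- path G u v is the sum, over the proof-trees of u cut at v, of the product
  -- of their leaves, where v lies on the heavy path from the root.
  path  : ∀ {M} → Gates M → Fin M → Fin M → Carrier
  pathᵒ : ∀ {M} → Gates M → Operand M → Fin M → Carrier
  path (G ▸ g)       (suc u) (suc v) = path G u v
  path (G ▸ g)       (suc u) zero    = 0#
  path (G ▸ g)       zero    zero    = 1#
  path (G ▸ add x y) zero    (suc v) = pathᵒ G x v +ᴿ pathᵒ G y v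
  path (G ▸ mul x y) zero    (suc v) = pathᵒ G (heavy G x y) v *ᴿ valᵒ G (light G x y)
  pathᵒ G (atom a) v = 0#
  pathᵒ G (gate u) v = path G u v

  -- `D ⊖ E` truncates, so it is a meaningful bound only if `E ≼ D`. For a gate that no heavy path
  -- from the root reaches, this may fail, but then the path polynomial is zero; hence the two
  -- alternatives.
  Below : Carrier → Vec ℕ n → Vec ℕ n → Set (c ⊔ ℓ)
  Below p D E = p ≈ 0# ⊎ (E ≼ D × p ⊑ D ⊖ E)

  ≼⇒⊖≼⊖ : ∀ {D D′} (E : Vec ℕ n) → E ≼ D → D ≼ D′ → D ⊖ E ≼ D′ ⊖ E
  ≼⇒⊖≼⊖ {D} {D′} E E≼D D≼D′ = ⊕≼⇒≼⊖ (D ⊖ E) (≼-trans (≼-reflexive (⊖-⊕ E≼D)) D≼D′)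

  Below-mono : ∀ {p D D′ E} → D ≼ D′ → Below p D E → Below p D′ E
  Below-mono D≼D′ (inj₁ p≈0) = inj₁ p≈0
  Below-mono {E = E} D≼D′ (inj₂ (E≼D , p⊑)) = inj₂ (≼-trans E≼D D≼D′ , ⊑-mono (≼⇒⊖≼⊖ E E≼D D≼D′) p⊑)

  Below-+ : ∀ {p q D E} → Below p D E → Below q D E → Below (p +ᴿ q) D E
  Below-+ (inj₁ p≈0) (inj₁ q≈0) = inj₁ (≈-trans (+-cong p≈0 q≈0) (+-identityˡ 0#))
  Below-+ (inj₁ p≈0) (inj₂ (E≼D , q⊑)) =
    inj₂ (E≼D , ⊑-resp (≈-trans (≈-sym (+-identityˡ _)) (+-congʳ (≈-sym p≈0))) q⊑)
  Below-+ (inj₂ (E≼D , p⊑)) (inj₁ q≈0) =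
    inj₂ (E≼D , ⊑-resp (≈-trans (≈-sym (+-identityʳ _)) (+-congˡ (≈-sym q≈0))) p⊑)
  Below-+ (inj₂ (E≼D , p⊑)) (inj₂ (_ , q⊑)) = inj₂ (E≼D , +-⊑ p⊑ q⊑)

  Below-* : ∀ {p q D D′ E} → Below p D E → q ⊑ D′ → Below (p *ᴿ q) (D ⊕ D′) E
  Below-* {q = q} (inj₁ p≈0) q⊑ = inj₁ (≈-trans (*-congʳ p≈0) (zeroˡ q))
  Below-* {D = D} {D′} {E} (inj₂ (E≼D , p⊑)) q⊑ =
    inj₂ (≼-trans E≼D (x≼x⊕y D D′) , ⊑-mono (⊕≼⇒≼⊖ _ (≼-reflexive eq)) (*-⊑ p⊑ q⊑))
    where
    eq : ((D ⊖ E) ⊕ D′) ⊕ E ≡ D ⊕ D′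
    eq = ≡.trans (⊕-assoc (D ⊖ E) D′ E) (≡.trans (cong ((D ⊖ E) ⊕_) (⊕-comm D′ E))
      (≡.trans (≡.sym (⊕-assoc (D ⊖ E) E D′)) (cong (_⊕ D′) (⊖-⊕ E≼D))))

  path-below  : ∀ {M} (G : Gates M) u v → Below (path G u v) (deg G u) (deg G v)
  pathᵒ-below : ∀ {M} (G : Gates M) x v → Below (pathᵒ G x v) (degᵒ G x) (deg G v)
  path-below (G ▸ g)       (suc u) (suc v) = path-below G u v
  path-below (G ▸ g)       (suc u) zero    = inj₁ ≈-refl
  path-below (G ▸ g)       zero    zero    = inj₂ (≼-refl , ⊑-mono (𝟎≼ _) 1#-⊑)
  path-below (G ▸ add x y) zero    (suc v) = Below-+
    (Below-mono (x≼x⊻y _ _) (pathᵒ-below G x v)) (Below-mono (y≼x⊻y _ _) (pathᵒ-below G y v))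
  path-below (G ▸ mul x y) zero    (suc v) = Below-mono (≼-reflexive (heavy⊕light G x y))
    (Below-* (pathᵒ-below G (heavy G x y) v) (valᵒ⊑ G (light G x y)))
  pathᵒ-below G (atom a) v = inj₁ ≈-refl
  pathᵒ-below G (gate u) v = path-below G u v

  -- Cutting heavy paths at a weight threshold

  module _ {M} (θ : ℕ) (G : Gates M) where
    restrict : Operand M → Carrier
    restrict x = if? weightᵒ G x ≤? θ then valᵒ G x else 0#

    -- The contribution of the proof-trees whose heavy path leaves the gates of
    -- weight > θ at the given node.
    exitⁿ : Node M → Carrier
    exitⁿ (add x y) = restrict x +ᴿ restrict y
    exitⁿ (mul x y) = restrict (heavy G x y) *ᴿ valᵒ G (light G x y)

  -- Zero at gates of weight at most `θ`, so that a cut can range over all gates without first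
  -- determining where the walks leave.
  exit : ∀ {M} → ℕ → Gates M → Fin M → Carrier
  exit θ (G ▸ g) zero    = if? θ <? weight (degⁿ G g) then exitⁿ θ G g else 0#
  exit θ (G ▸ g) (suc v) = exit θ G v

  cut : ∀ {M} → ℕ → Gates M → Operand M → Carrier
  cut θ G x = sum (λ v → pathᵒ G x v *ᴿ exit θ G v)

  exit≈0 : ∀ {M} θ (G : Gates M) v → weight (deg G v) ≤ θ → exit θ G v ≈ 0#
  exit≈0 θ (G ▸ g) zero w≤θ with θ <? weight (degⁿ G g)
  ... | yes θ<w = contradiction θ<w (ℕ.≤⇒≯ w≤θ)
  ... | no _    = ≈-refl
  exit≈0 θ (G ▸ g) (suc v) w≤θ = exit≈0 θ G v w≤θ

  exit-zero : ∀ {M} θ (G : Gates M) g → θ < weight (degⁿ G g) → exit θ (G ▸ g) zero ≈ exitⁿ θ G g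
  exit-zero θ G g θ<w with θ <? weight (degⁿ G g)
  ... | yes _  = ≈-refl
  ... | no θ≮w = contradiction θ<w θ≮w

  sum≈0 : ∀ {m} {f : Vector Carrier m} → (∀ i → f i ≈ 0#) → sum f ≈ 0#
  sum≈0 {m} f≈0 = ≈-trans (sum-cong-≋ f≈0) (sum-replicate-zero m)

  -- A gate either has zero path polynomial from `x` or has degree vector below that of `x`; in the
  -- latter case it too is light and its exit vanishes.
  cut≈0 : ∀ {M} θ (G : Gates M) x → weightᵒ G x ≤ θ → cut θ G x ≈ 0#
  cut≈0 θ G x w≤θ = sum≈0 λ v → case pathᵒ-below G x v of λ where
    (inj₁ p≈0)      → ≈-trans (*-congʳ p≈0) (zeroˡ _)
    (inj₂ (v≼x , _)) → ≈-trans (*-congˡ (exit≈0 θ G v (ℕ.≤-trans (weight-mono v≼x) w≤θ))) (zeroʳ _)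

  module _ {θ} (1≤θ : 1 ≤ θ) where
    -- The walks from `u` either leave at once, which is the summand of `u` itself, or continue into
    -- a child that is still heavy. At a product only the heavier factor is opened; the other
    -- multiplies the whole cut and is absorbed into the path polynomials.
    val≈cut : ∀ {M} (G : Gates M) u → θ < weight (deg G u) → val G u ≈ cut θ G (gate u)

    -- Exactly one summand survives, depending on whether `x` is below the threshold. Here `1 ≤ θ`
    -- is essential: an atom above the threshold would have neither a restricted value nor a cut.
    restrict+cut : ∀ {M} (G : Gates M) x → restrict θ G x +ᴿ cut θ G x ≈ valᵒ G x
    restrict+cut G x with weightᵒ G x ≤? θ
    restrict+cut G x        | yes w≤θ = ≈-trans (+-congˡ (cut≈0 θ G x w≤θ)) (+-identityʳ _)
    restrict+cut G (atom a) | no w≰θ  = contradiction (ℕ.≤-trans (weight≤1 a) 1≤θ) w≰θ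
    restrict+cut G (gate u) | no w≰θ  = ≈-trans (+-identityˡ _) (≈-sym (val≈cut G u (ℕ.≰⇒> w≰θ)))

    val≈cut (G ▸ g) (suc u) θ<w = begin
      val G u                                    ≈⟨ val≈cut G u θ<w ⟩
      cut θ G (gate u)                           ≈⟨ +-identityˡ _ ⟨
      0# +ᴿ cut θ G (gate u)                     ≈⟨ +-congʳ (zeroˡ _) ⟨
      0# *ᴿ exit θ (G ▸ g) zero +ᴿ cut θ G (gate u) ∎
    val≈cut {suc M} (G ▸ add x y) zero θ<w = begin
      valᵒ G x +ᴿ valᵒ G y                       ≈⟨ +-cong (restrict+cut G x) (restrict+cut G y) ⟨
      (restrict θ G x +ᴿ cut θ G x) +ᴿ (restrict θ G y +ᴿ cut θ G y)  ≈⟨ interchange _ _ _ _ ⟩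
      exitⁿ θ G (add x y) +ᴿ (cut θ G x +ᴿ cut θ G y)
        ≈⟨ +-cong (≈-trans (*-identityˡ _) (exit-zero θ G (add x y) θ<w))
             (≈-trans (sum-cong-≋ {M} λ v → distribʳ _ _ _) (∑-distrib-+ {M} _ _)) ⟨
      1# *ᴿ exit θ (G ▸ add x y) zero +ᴿ sum (λ v → (pathᵒ G x v +ᴿ pathᵒ G y v) *ᴿ exit θ G v) ∎
      where open import Algebra.Properties.CommutativeSemigroup +-commutativeSemigroup using (interchange)
    val≈cut {suc M} (G ▸ mul x y) zero θ<w = begin
      valᵒ G x *ᴿ valᵒ G y                       ≈⟨ heavy*light G x y ⟨
      valᵒ G h *ᴿ valᵒ G l                       ≈⟨ *-congʳ (restrict+cut G h) ⟨
      (restrict θ G h +ᴿ cut θ G h) *ᴿ valᵒ G l  ≈⟨ distribʳ _ _ _ ⟩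
      exitⁿ θ G (mul x y) +ᴿ cut θ G h *ᴿ valᵒ G l
        ≈⟨ +-cong (≈-trans (≈-sym (exit-zero θ G (mul x y) θ<w)) (≈-sym (*-identityˡ _)))
             (≈-trans (*-distribʳ-sum {M} _ _) (sum-cong-≋ {M} λ v → xy∙z≈xz∙y _ _ _)) ⟩
      1# *ᴿ exit θ (G ▸ mul x y) zero +ᴿ sum (λ v → (pathᵒ G h v *ᴿ valᵒ G l) *ᴿ exit θ G v) ∎
      where
      h = heavy G x y
      l = light G x y

  -- Sums of products of pieces of low degree

  module _ (t : ℕ) where
    record Piece : Set (c ⊔ ℓ) where
      field
        value    : Carrier
        bound    : Vec ℕ n
        value⊑   : value ⊑ bound
        weight≤t : weight bound ≤ t

    ∏ : List Piece → Carrier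
    ∏ []       = 1#
    ∏ (P ∷ Ps) = Piece.value P *ᴿ ∏ Ps

    ∑∏ : List (List Piece) → Carrier
    ∑∏ []         = 0#
    ∑∏ (Ps ∷ Pss) = ∏ Ps +ᴿ ∑∏ Pss

    ⨁ : List Piece → Vec ℕ n
    ⨁ []       = 𝟎
    ⨁ (P ∷ Ps) = Piece.bound P ⊕ ⨁ Ps

    ∏-++ : ∀ Ps Qs → ∏ (Ps ++ Qs) ≈ ∏ Ps *ᴿ ∏ Qs
    ∏-++ []       Qs = ≈-sym (*-identityˡ _)
    ∏-++ (P ∷ Ps) Qs = ≈-trans (*-congˡ (∏-++ Ps Qs)) (≈-sym (*-assoc _ _ _))

    ⨁-++ : ∀ Ps Qs → ⨁ (Ps ++ Qs) ≡ ⨁ Ps ⊕ ⨁ Qs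
    ⨁-++ []       Qs = ≡.sym (⊕-identityˡ _)
    ⨁-++ (P ∷ Ps) Qs = ≡.trans (cong (Piece.bound P ⊕_) (⨁-++ Ps Qs)) (≡.sym (⊕-assoc (Piece.bound P) _ _))

    ∑∏-++ : ∀ Pss Qss → ∑∏ (Pss ++ Qss) ≈ ∑∏ Pss +ᴿ ∑∏ Qss
    ∑∏-++ []         Qss = ≈-sym (+-identityˡ _)
    ∑∏-++ (Ps ∷ Pss) Qss = ≈-trans (+-congˡ (∑∏-++ Pss Qss)) (≈-sym (+-assoc _ _ _))

    ∑∏-map-++ : ∀ Ps Qss → ∑∏ (map (Ps ++_) Qss) ≈ ∏ Ps *ᴿ ∑∏ Qss
    ∑∏-map-++ Ps []         = ≈-sym (zeroʳ _)
    ∑∏-map-++ Ps (Qs ∷ Qss) =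
      ≈-trans (+-cong (∏-++ Ps Qs) (∑∏-map-++ Ps Qss)) (≈-sym (distribˡ _ _ _))

    infixl 7 _⊗_
    _⊗_ : List (List Piece) → List (List Piece) → List (List Piece)
    _⊗_ = cartesianProductWith _++_

    ∑∏-⊗ : ∀ Pss Qss → ∑∏ (Pss ⊗ Qss) ≈ ∑∏ Pss *ᴿ ∑∏ Qss
    ∑∏-⊗ []         Qss = ≈-sym (zeroˡ _)
    ∑∏-⊗ (Ps ∷ Pss) Qss = begin
      ∑∏ (map (Ps ++_) Qss ++ Pss ⊗ Qss)          ≈⟨ ∑∏-++ (map (Ps ++_) Qss) _ ⟩
      ∑∏ (map (Ps ++_) Qss) +ᴿ ∑∏ (Pss ⊗ Qss)     ≈⟨ +-cong (∑∏-map-++ Ps Qss) (∑∏-⊗ Pss Qss) ⟩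
      ∏ Ps *ᴿ ∑∏ Qss +ᴿ ∑∏ Pss *ᴿ ∑∏ Qss          ≈⟨ distribʳ _ _ _ ⟨
      (∏ Ps +ᴿ ∑∏ Pss) *ᴿ ∑∏ Qss                  ∎

    -- `bounded` concerns the declared bounds of the factors, not the true degrees of their product:
    -- the depth-4 circuit inherits its `Var` from the former.
    record Expansion (p : Carrier) (D : Vec ℕ n) (A N : ℕ) : Set (c ⊔ ℓ) where
      field
        terms    : List (List Piece)
        correct  : ∑∏ terms ≈ p
        bounded  : All (λ Ps → ⨁ Ps ≼ D) terms
        length≤  : length terms ≤ A
        factors≤ : All (λ Ps → length Ps ≤ N) terms

    private
      variable
        p q : Carrier
        D E : Vec ℕ n
        A A′ N N′ : ℕ

    weaken : p ≈ q → D ≼ E → A ≤ A′ → N ≤ N′ → Expansion p D A N → Expansion q E A′ N′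
    weaken p≈q D≼E A≤ N≤ X = record
      { terms    = terms
      ; correct  = ≈-trans correct p≈q
      ; bounded  = All.map (λ ≼D → ≼-trans ≼D D≼E) bounded
      ; length≤  = ℕ.≤-trans length≤ A≤
      ; factors≤ = All.map (λ ≤N → ℕ.≤-trans ≤N N≤) factors≤ }
      where open Expansion X

    zeroᴱ : Expansion 0# D A N
    zeroᴱ = record { terms = [] ; correct = ≈-refl ; bounded = [] ; length≤ = z≤n ; factors≤ = [] }

    pieceᴱ : p ⊑ D → weight D ≤ t → Expansion p D 1 1
    pieceᴱ {p} {D} p⊑D w≤t = record
      { terms    = (P ∷ []) ∷ []
      ; correct  = ≈-trans (+-identityʳ _) (*-identityʳ _)
      ; bounded  = ≼-reflexive (≡.trans (⊕-comm D 𝟎) (⊕-identityˡ D)) ∷ []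
      ; length≤  = ℕ.≤-refl
      ; factors≤ = ℕ.≤-refl ∷ [] }
      where
      P : Piece
      P = record { value = p ; bound = D ; value⊑ = p⊑D ; weight≤t = w≤t }

    infixl 6 _+ᴱ_
    _+ᴱ_ : Expansion p D A N → Expansion q D A′ N → Expansion (p +ᴿ q) D (A + A′) N
    X +ᴱ Y = record
      { terms    = X.terms ++ Y.terms
      ; correct  = ≈-trans (∑∏-++ X.terms Y.terms) (+-cong X.correct Y.correct)
      ; bounded  = All.++⁺ X.bounded Y.bounded
      ; length≤  = ℕ.≤-trans (ℕ.≤-reflexive (length-++ X.terms)) (ℕ.+-mono-≤ X.length≤ Y.length≤)
      ; factors≤ = All.++⁺ X.factors≤ Y.factors≤ }
      where
      module X = Expansion X
      module Y = Expansion Y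

    sumᴱ : ∀ {m} {f : Vector Carrier m} → (∀ i → Expansion (f i) D A N) → Expansion (sum f) D (m * A) N
    sumᴱ {m = zero}  X = zeroᴱ
    sumᴱ {m = suc m} X = X zero +ᴱ sumᴱ (X ∘ suc)

    infixl 7 _*ᴱ_
    _*ᴱ_ : Expansion p D A N → Expansion q E A′ N′ → Expansion (p *ᴿ q) (D ⊕ E) (A * A′) (N + N′)
    X *ᴱ Y = record
      { terms    = X.terms ⊗ Y.terms
      ; correct  = ≈-trans (∑∏-⊗ X.terms Y.terms) (*-cong X.correct Y.correct)
      ; bounded  = All.cartesianProductWith⁺ (≡.setoid _) (≡.setoid _) _++_ X.terms Y.terms λ {Ps} {Qs} Ps∈ Qs∈ →
          ≼-trans (≼-reflexive (⨁-++ Ps Qs)) (⊕-mono-≼ (All.lookup X.bounded Ps∈) (All.lookup Y.bounded Qs∈))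
      ; length≤  = ℕ.≤-trans (ℕ.≤-reflexive (length-cartesianProductWith _++_ X.terms Y.terms))
          (ℕ.*-mono-≤ X.length≤ Y.length≤)
      ; factors≤ = All.cartesianProductWith⁺ (≡.setoid _) (≡.setoid _) _++_ X.terms Y.terms λ {Ps} {Qs} Ps∈ Qs∈ →
          ℕ.≤-trans (ℕ.≤-reflexive (length-++ Ps))
            (ℕ.+-mono-≤ (All.lookup X.factors≤ Ps∈) (All.lookup Y.factors≤ Qs∈)) }
      where
      module X = Expansion X
      module Y = Expansion Y

    -- Iterating the cut

    module _ .{{_ : NonZero t}} (1≤t : 1 ≤ t) (s : ℕ) where
      -- A cut chooses one of at most `s` gates and, at a sum gate, one of two children, whence a
      -- factor `s + s` per unit of budget. It adds one path piece and may split one remaining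
      -- factor into two, whence two more factors per unit.
      ExpansionOf : ∀ {M} → Gates M → Operand M → Set (c ⊔ ℓ)
      ExpansionOf G x = Expansion (valᵒ G x) (degᵒ G x)
        ((s + s) ^ budget t w) (suc (2 * budget t w))
        where w = weightᵒ G x

      expand-small : ∀ {M} (G : Gates M) x → weightᵒ G x ≤ t → ExpansionOf G x
      expand-small G x w≤t rewrite budget-small t w≤t = pieceᴱ (valᵒ⊑ G x) w≤t

      module _ {w e} (t<w : t < w) (eq : budget t w ≡ suc e) where
        private
          θ = w ∸ t
          X = (s + s) ^ e

          ≤θ⇒ : ∀ {a} → a ≤ θ → a + t ≤ w
          ≤θ⇒ a≤θ = ℕ.m≤o∸n⇒m+n≤o _ (ℕ.<⇒≤ t<w) a≤θ

        module _ {M} (1≤s : 1 ≤ s) (G : Gates M) (expand : ∀ x → ExpansionOf G x) where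
          private
            instance
              2s≢0 : NonZero (s + s)
              2s≢0 = >-nonZero (ℕ.≤-trans 1≤s (ℕ.m≤m+n s s))
            wᵒ = weightᵒ G

            budget≤ : ∀ {a b} → a ≤ θ → b ≤ θ → a + b ≤ w → budget t a + budget t b ≤ e
            budget≤ a≤θ b≤θ a+b≤w = s≤s⁻¹ (subst (_ ≤_) eq
              (budget-split t t<w (≤θ⇒ a≤θ) (≤θ⇒ b≤θ) a+b≤w))

            budget≤₁ : ∀ {a} → a ≤ θ → budget t a ≤ e
            budget≤₁ {a} a≤θ = ℕ.≤-trans (ℕ.m≤m+n _ (budget t 0))
              (budget≤ {a} {0} a≤θ z≤n (ℕ.≤-trans (ℕ.≤-reflexive (ℕ.+-identityʳ a)) (ℕ.≤-trans a≤θ (ℕ.m∸n≤m w t))))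

          expand-restrict : ∀ x {D} → degᵒ G x ≼ D →
            Expansion (restrict θ G x) D X (2 + 2 * e)
          expand-restrict x x≼D with wᵒ x ≤? θ
          ... | no _    = zeroᴱ
          ... | yes x≤θ = weaken ≈-refl x≼D (ℕ.^-monoʳ-≤ (s + s) (budget≤₁ x≤θ))
            (ℕ.≤-trans (s≤s (ℕ.*-monoʳ-≤ 2 (budget≤₁ x≤θ))) (ℕ.n≤1+n _)) (expand x)

          -- At a sum the children are alternatives, so the two counts add up to `X + X`. At a
          -- product the counts multiply, but `budget-split` has set one unit aside for the cut and
          -- bounds the sum of both budgets by `e`. It applies to the light factor as well, which is
          -- below the threshold because the heavy one is.
          expand-exitⁿ : ∀ g → weight (degⁿ G g) ≤ w →
            Expansion (exitⁿ θ G g) (degⁿ G g) (X + X) (2 + 2 * e)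
          expand-exitⁿ (add x y) g≤w = expand-restrict x (x≼x⊻y _ _) +ᴱ expand-restrict y (y≼x⊻y _ _)
          expand-exitⁿ (mul x y) g≤w with wᵒ (heavy G x y) ≤? θ
          ... | no _    = weaken (≈-sym (zeroˡ _)) ≼-refl ℕ.≤-refl ℕ.≤-refl zeroᴱ
          ... | yes h≤θ = weaken ≈-refl (≼-reflexive (heavy⊕light G x y))
            (ℕ.≤-trans (ℕ.≤-reflexive (≡.sym (ℕ.^-distribˡ-+-* (s + s) (budget t (wᵒ h)) (budget t (wᵒ l)))))
              (ℕ.≤-trans (ℕ.^-monoʳ-≤ (s + s) b≤e) (ℕ.m≤m+n X X)))
            (ℕ.≤-trans (ℕ.≤-reflexive (double (budget t (wᵒ h)) (budget t (wᵒ l))))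
              (ℕ.+-monoʳ-≤ 2 (ℕ.*-monoʳ-≤ 2 b≤e)))
            (expand h *ᴱ expand l)
            where
            h = heavy G x y
            l = light G x y
            h+l≤w : wᵒ h + wᵒ l ≤ w
            h+l≤w = ℕ.≤-trans (ℕ.≤-reflexive (≡.trans (≡.sym (weight-⊕ (degᵒ G h) (degᵒ G l)))
              (cong weight (heavy⊕light G x y)))) g≤w
            b≤e : budget t (wᵒ h) + budget t (wᵒ l) ≤ e
            b≤e = budget≤ h≤θ (ℕ.≤-trans (light≤heavy G x y) h≤θ) h+l≤w
            double : ∀ a b → suc (2 * a) + suc (2 * b) ≡ 2 + 2 * (a + b)
            double = solve-∀

        -- The children of `v` live in the prefix of the graph before `v`, so the expansions needed
        -- are those over strictly shorter graphs; this is what makes the recursion of `expand`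
        -- terminate.
        expand-exit : ∀ {M} (G : Gates M) v → 1 ≤ s → weight (deg G v) ≤ w →
          (∀ {M′} → M′ < M → (G′ : Gates M′) → ∀ x → ExpansionOf G′ x) →
          Expansion (exit θ G v) (deg G v) (X + X) (2 + 2 * e)
        expand-exit (G ▸ g) zero 1≤s v≤w expand with θ <? weight (degⁿ G g)
        ... | no _  = zeroᴱ
        ... | yes _ = expand-exitⁿ 1≤s G (expand ℕ.≤-refl G) g v≤w
        expand-exit (G ▸ g) (suc v) 1≤s v≤w expand = expand-exit G v 1≤s v≤w (λ M′<M → expand (ℕ.m<n⇒m<1+n M′<M))

      -- `j` bounds the length of the graph and serves as the recursion argument, while `s` stays
      -- fixed as the bound on the number of choices in every cut.
      expand : ∀ j {M} → M ≤ j → M ≤ s → (G : Gates M) → ∀ x → ExpansionOf G x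
      expand j M≤j M≤s G x with weightᵒ G x ≤? t
      expand j M≤j M≤s G x        | yes w≤t = expand-small G x w≤t
      expand j M≤j M≤s G (atom a) | no w≰t  = contradiction (ℕ.≤-trans (Atom.weight≤1 a) 1≤t) w≰t
      expand zero {suc M} () M≤s G (gate u) | no w≰t
      expand (suc j) {M} M≤j M≤s G (gate u) | no w≰t with budget t (weightᵒ G (gate u)) in eq
      -- Splitting `w` into two parts of weight zero already needs one unit, so the budget is
      -- positive above `t`.
      ... | zero  = contradiction (budget-split t t<w (ℕ.<⇒≤ t<w) (ℕ.<⇒≤ t<w) z≤n)
        (λ le → ℕ.n≮0 (subst (_ ≤_) eq le))
        where t<w = ℕ.≰⇒> w≰t
      ... | suc e = weaken (≈-sym (val≈cut 1≤θ G u θ<w)) ≼-refl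
          (ℕ.≤-trans (ℕ.*-monoˡ-≤ (X + X) M≤s) (ℕ.≤-reflexive (double s X))) (ℕ.≤-reflexive (factors e))
          (sumᴱ term)
        where
        w = weight (deg G u)
        t<w = ℕ.≰⇒> w≰t
        θ = w ∸ t
        X = (s + s) ^ e
        1≤θ : 1 ≤ θ
        1≤θ = ℕ.m<n⇒0<n∸m t<w
        θ<w : θ < w
        θ<w = ℕ.∸-monoʳ-< {w} {t} {0} 1≤t (ℕ.<⇒≤ t<w)
        1≤s : 1 ≤ s
        1≤s = ℕ.≤-trans (nonempty u) M≤s
          where
          nonempty : ∀ {M} → Fin M → 1 ≤ M
          nonempty {suc _} _ = s≤s z≤n
        double : ∀ s X → s * (X + X) ≡ (s + s) * X
        double = solve-∀
        factors : ∀ e → 1 + (2 + 2 * e) ≡ suc (2 * suc e)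
        factors = solve-∀
        term : ∀ v → Expansion (path G u v *ᴿ exit θ G v)
          (deg G u) (X + X) (1 + (2 + 2 * e))
        -- Only a gate above the threshold with `deg G v ≼ deg G u` is left with a real
        -- contribution; then the path polynomial has lost at most `t` of weight and is a single
        -- piece.
        term v with weight (deg G v) ≤? θ | path-below G u v
        ... | yes v≤θ | _ = weaken (≈-sym (≈-trans (*-congˡ (exit≈0 θ G v v≤θ)) (zeroʳ _)))
          ≼-refl ℕ.≤-refl ℕ.≤-refl zeroᴱ
        ... | no _ | inj₁ p≈0 = weaken (≈-sym (≈-trans (*-congʳ p≈0) (zeroˡ _)))
          ≼-refl ℕ.≤-refl ℕ.≤-refl zeroᴱ
        ... | no v≰θ | inj₂ (v≼u , p⊑) = weaken ≈-refl (≼-reflexive (⊖-⊕ v≼u))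
          (ℕ.≤-reflexive (ℕ.*-identityˡ (X + X))) ℕ.≤-refl
          (pieceᴱ p⊑ drop≤t *ᴱ
            (expand-exit t<w eq G v 1≤s (weight-mono v≼u) λ M′<M →
              expand j (s≤s⁻¹ (ℕ.≤-trans M′<M M≤j)) (ℕ.≤-trans (ℕ.<⇒≤ M′<M) M≤s)))
          where
          drop≤t : weight (deg G u ⊖ deg G v) ≤ t
          drop≤t = weight-⊖-≤ v≼u (ℕ.≤-trans (ℕ.≤-reflexive (≡.sym (ℕ.m+[n∸m]≡n (ℕ.<⇒≤ t<w))))
            (ℕ.+-monoʳ-≤ t (ℕ.<⇒≤ (ℕ.≰⇒> v≰θ))))

-- Exponent vectors below a bound, and monomials as lists of variables

box : ∀ {n} → Vec ℕ n → List (Vec ℕ n)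
box []      = [] ∷ []
box (d ∷ D) = cartesianProductWith _∷_ (upTo (suc d)) (box D)

box-unique : ∀ {n} (D : Vec ℕ n) → Unique (box D)
box-unique []      = [] ∷ []
box-unique (d ∷ D) = Unique.cartesianProductWith⁺ _∷_ Vec.∷-injective (Unique.upTo⁺ (suc d)) (box-unique D)

∈-box⁺ : ∀ {n} {e D : Vec ℕ n} → e ≼ D → e ∈ box D
∈-box⁺ []           = here refl
∈-box⁺ (e≤d ∷ e≼D) = ∈-cartesianProductWith⁺ _∷_ (∈-upTo⁺ (s≤s e≤d)) (∈-box⁺ e≼D)

∈-box⁻ : ∀ {n} {e : Vec ℕ n} D → e ∈ box D → e ≼ D
∈-box⁻ []      (here refl) = []
∈-box⁻ (d ∷ D) e∈ with ∈-cartesianProductWith⁻ _∷_ (upTo (suc d)) (box D) e∈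
... | _ , _ , i∈ , e∈ , refl = s≤s⁻¹ (∈-upTo⁻ i∈) ∷ ∈-box⁻ D e∈

suc≤2^ : ∀ d → suc d ≤ 2 ^ d
suc≤2^ zero    = s≤s z≤n
suc≤2^ (suc d) = ℕ.+-mono-≤ (ℕ.m^n>0 2 d) (ℕ.≤-trans (suc≤2^ d) (ℕ.m≤m+n _ 0))

-- The box has one factor `d + 1 ≤ 2 ^ d` per coordinate, so the bound depends only on the weight
-- and not on `n`.
length-box : ∀ {n} (D : Vec ℕ n) → length (box D) ≤ 2 ^ weight D
length-box []      = ℕ.≤-refl
length-box (d ∷ D) = begin
  length (box (d ∷ D))                    ≡⟨ length-cartesianProductWith _∷_ (upTo (suc d)) (box D) ⟩
  length (upTo (suc d)) * length (box D)  ≡⟨ cong (_* length (box D)) (length-upTo (suc d)) ⟩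
  suc d * length (box D)                  ≤⟨ ℕ.*-mono-≤ (suc≤2^ d) (length-box D) ⟩
  2 ^ d * 2 ^ weight D                    ≡⟨ ℕ.^-distribˡ-+-* 2 d (weight D) ⟨
  2 ^ (d + weight D)                      ∎
  where open ℕ.≤-Reasoning

variables : ∀ {n} → Vec ℕ n → List (Fin n)
variables []      = []
variables (d ∷ e) = replicate d zero ++ map suc (variables e)

degrees : ∀ {n} → List (Fin n) → Vec ℕ n
degrees is = foldr _⊕_ 𝟎 (map unit is)

degrees-suc : ∀ {n} (is : List (Fin n)) → degrees (map suc is) ≡ 0 ∷ degrees is
degrees-suc []       = refl
degrees-suc (i ∷ is) = cong (unit (suc i) ⊕_) (degrees-suc is)

degrees-variables : ∀ {n} (e : Vec ℕ n) → degrees (variables e) ≡ e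
degrees-variables []      = refl
degrees-variables (d ∷ e) = go d
  where
  go : ∀ d → degrees (replicate d zero ++ map suc (variables e)) ≡ d ∷ e
  go zero    = ≡.trans (degrees-suc (variables e)) (cong (0 ∷_) (degrees-variables e))
  go (suc d) = ≡.trans (cong (unit zero ⊕_) (go d)) (cong (suc d ∷_) (⊕-identityˡ e))

length-variables : ∀ {n} (e : Vec ℕ n) → length (variables e) ≡ weight e
length-variables e = ≡.trans (go (variables e)) (cong weight (degrees-variables e))
  where
  go : ∀ {n} (is : List (Fin n)) → length is ≡ weight (degrees is)
  go {n} []       = ≡.sym (weight-𝟎 n)
  go     (i ∷ is) = ≡.sym (≡.trans (weight-⊕ (unit i) (degrees is))
    (cong₂ _+_ (weight-unit i) (≡.sym (go is))))

-- Degree vectors only grow towards the root, at sums and, by the next lemma, at products. Hence a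
-- bound at the root of a tree makes the whole tree multi-k-ic.
summand≼⨆ : ∀ {n k} (Ds : List (Vec ℕ n)) → Vec.All (_≤ k) (foldr _⊻_ 𝟎 Ds) → All (Vec.All (_≤ k)) Ds
summand≼⨆ []       ok = []
summand≼⨆ (D ∷ Ds) ok = All-≼ (x≼x⊻y D _) ok ∷ summand≼⨆ Ds (All-≼ (y≼x⊻y D _) ok)

summand≼⨁ : ∀ {n k} (Ds : List (Vec ℕ n)) → Vec.All (_≤ k) (foldr _⊕_ 𝟎 Ds) → All (Vec.All (_≤ k)) Ds
summand≼⨁ []       ok = []
summand≼⨁ (D ∷ Ds) ok = All-≼ (x≼x⊕y D _) ok ∷ summand≼⨁ Ds (All-≼ (y≼x⊕y D _) ok)

-- The edges below a gate with one leaf and L children of size b.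
level : ℕ → ℕ → ℕ
level L b = suc (L * suc b)

level-mono : ∀ {L L′ b b′} → L ≤ L′ → b ≤ b′ → level L b ≤ level L′ b′
level-mono L≤ b≤ = s≤s (ℕ.*-mono-≤ L≤ (s≤s b≤))

-- The semiring of polynomials

module _ {c ℓ₁ ℓ₂} (F : HeytingField c ℓ₁ ℓ₂) (n : ℕ) where
  private
    module F = CommutativeRing (HeytingCommutativeRing.commutativeRing (HeytingField.heytingCommutativeRing F))
    open import Relation.Binary.Reasoning.Setoid F.setoid
    open import Algebra.Properties.CommutativeSemigroup F.*-commutativeSemigroup using (x∙yz≈y∙xz)
    open import Algebra.Properties.CommutativeSemigroup F.+-commutativeSemigroup using (interchange)

    Poly = Polynomial F n

    infixl 7 _⊠_
    _⊠_ : Poly → Poly → Poly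
    _⊠_ = _*ₚ_ F n

    -- The linear functional that sends the monomial with exponents `d` to `φ d`. Unlike `coeff`, it
    -- turns a product into a nested evaluation (`⟦⟧-⊠`), so the ring laws reduce to laws of finite
    -- sums; the functional of `δ e` recovers the coefficient at `e`.
    ⟦_⟧ : Poly → (Vec ℕ n → F.Carrier) → F.Carrier
    ⟦ [] ⟧          φ = F.0#
    ⟦ (a , d) ∷ p ⟧ φ = a F.* φ d F.+ ⟦ p ⟧ φ

    δ : Vec ℕ n → Vec ℕ n → F.Carrier
    δ e d = if does (≡-dec _≟_ d e) then F.1# else F.0#

    coeff-⟦⟧ : ∀ p e → coeff F n p e F.≈ ⟦ p ⟧ (δ e)
    coeff-⟦⟧ []            e = F.refl
    coeff-⟦⟧ ((a , d) ∷ p) e with ≡-dec _≟_ d e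
    ... | yes _ = F.+-cong (F.sym (F.*-identityʳ a)) (coeff-⟦⟧ p e)
    ... | no  _ = F.+-cong (F.sym (F.zeroʳ a)) (coeff-⟦⟧ p e)

    ⟦⟧-cong : ∀ p {φ ψ} → (∀ d → φ d F.≈ ψ d) → ⟦ p ⟧ φ F.≈ ⟦ p ⟧ ψ
    ⟦⟧-cong []            φ≈ψ = F.refl
    ⟦⟧-cong ((a , d) ∷ p) φ≈ψ = F.+-cong (F.*-congˡ (φ≈ψ d)) (⟦⟧-cong p φ≈ψ)

    ⟦⟧-zero : ∀ p → ⟦ p ⟧ (λ _ → F.0#) F.≈ F.0#
    ⟦⟧-zero []            = F.refl
    ⟦⟧-zero ((a , d) ∷ p) = F.trans (F.+-cong (F.zeroʳ a) (⟦⟧-zero p)) (F.+-identityˡ _)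

    ⟦⟧-+ : ∀ p φ ψ → ⟦ p ⟧ (λ d → φ d F.+ ψ d) F.≈ ⟦ p ⟧ φ F.+ ⟦ p ⟧ ψ
    ⟦⟧-+ []            φ ψ = F.sym (F.+-identityˡ _)
    ⟦⟧-+ ((a , d) ∷ p) φ ψ = F.trans (F.+-cong (F.distribˡ a _ _) (⟦⟧-+ p φ ψ)) (interchange _ _ _ _)

    ⟦⟧-* : ∀ p b φ → ⟦ p ⟧ (λ d → b F.* φ d) F.≈ b F.* ⟦ p ⟧ φ
    ⟦⟧-* []            b φ = F.sym (F.zeroʳ b)
    ⟦⟧-* ((a , d) ∷ p) b φ =
      F.trans (F.+-cong (x∙yz≈y∙xz a b (φ d)) (⟦⟧-* p b φ)) (F.sym (F.distribˡ b _ _))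

    ⟦⟧-++ : ∀ p q φ → ⟦ p ++ q ⟧ φ F.≈ ⟦ p ⟧ φ F.+ ⟦ q ⟧ φ
    ⟦⟧-++ []            q φ = F.sym (F.+-identityˡ _)
    ⟦⟧-++ ((a , d) ∷ p) q φ = F.trans (F.+-congˡ (⟦⟧-++ p q φ)) (F.sym (F.+-assoc _ _ _))

    ⟦⟧-scale : ∀ a d q φ → ⟦ map (λ (b , e) → (a F.* b , d ⊕ e)) q ⟧ φ F.≈ a F.* ⟦ q ⟧ (λ e → φ (d ⊕ e))
    ⟦⟧-scale a d []            φ = F.sym (F.zeroʳ a)
    ⟦⟧-scale a d ((b , e) ∷ q) φ =
      F.trans (F.+-cong (F.*-assoc a b _) (⟦⟧-scale a d q φ)) (F.sym (F.distribˡ a _ _))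

    ⟦⟧-⊠ : ∀ p q φ → ⟦ p ⊠ q ⟧ φ F.≈ ⟦ p ⟧ (λ d → ⟦ q ⟧ (λ e → φ (d ⊕ e)))
    ⟦⟧-⊠ []            q φ = F.refl
    ⟦⟧-⊠ ((a , d) ∷ p) q φ =
      F.trans (⟦⟧-++ (map _ q) (p ⊠ q) φ) (F.+-cong (⟦⟧-scale a d q φ) (⟦⟧-⊠ p q φ))

    ⟦⟧-swap : ∀ p q (φ : Vec ℕ n → Vec ℕ n → F.Carrier) →
      ⟦ p ⟧ (λ d → ⟦ q ⟧ (φ d)) F.≈ ⟦ q ⟧ (λ e → ⟦ p ⟧ (λ d → φ d e))
    ⟦⟧-swap []            q φ = F.sym (⟦⟧-zero q)
    ⟦⟧-swap ((a , d) ∷ p) q φ = begin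
      a F.* ⟦ q ⟧ (φ d) F.+ ⟦ p ⟧ (λ d → ⟦ q ⟧ (φ d))
        ≈⟨ F.+-cong (F.sym (⟦⟧-* q a (φ d))) (⟦⟧-swap p q φ) ⟩
      ⟦ q ⟧ (λ e → a F.* φ d e) F.+ ⟦ q ⟧ (λ e → ⟦ p ⟧ (λ d → φ d e))
        ≈⟨ ⟦⟧-+ q _ _ ⟨
      ⟦ q ⟧ (λ e → a F.* φ d e F.+ ⟦ p ⟧ (λ d → φ d e)) ∎

    infix 4 _≈ₚ_
    _≈ₚ_ : Poly → Poly → Set ℓ₁
    _≈ₚ_ = _≋_ F n

    ⟦⟧⇒≈ₚ : ∀ {p q} → (∀ φ → ⟦ p ⟧ φ F.≈ ⟦ q ⟧ φ) → p ≈ₚ q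
    ⟦⟧⇒≈ₚ {p} {q} eq e = F.trans (coeff-⟦⟧ p e) (F.trans (eq (δ e)) (F.sym (coeff-⟦⟧ q e)))

    ≈ₚ⇒⟦δ⟧ : ∀ {p q} → p ≈ₚ q → ∀ e → ⟦ p ⟧ (δ e) F.≈ ⟦ q ⟧ (δ e)
    ≈ₚ⇒⟦δ⟧ {p} {q} eq e = F.trans (F.sym (coeff-⟦⟧ p e)) (F.trans (eq e) (coeff-⟦⟧ q e))

    δ-shift : ∀ d r d′ → δ (d ⊕ r) (d ⊕ d′) F.≈ δ r d′
    δ-shift d r d′ with ≡-dec _≟_ (d ⊕ d′) (d ⊕ r) | ≡-dec _≟_ d′ r
    ... | yes _  | yes _  = F.refl
    ... | no _   | no _   = F.refl
    ... | yes eq | no ¬eq = contradiction (⊕-cancelˡ d eq) ¬eq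
    ... | no ¬eq | yes eq = contradiction (cong (d ⊕_) eq) ¬eq

    δ-absent : ∀ d {e} → ¬ (∃ λ r → d ⊕ r ≡ e) → ∀ d′ → δ e (d ⊕ d′) F.≈ F.0#
    δ-absent d {e} ∄ d′ with ≡-dec _≟_ (d ⊕ d′) e
    ... | yes eq = contradiction (d′ , eq) ∄
    ... | no _   = F.refl

    -- d′ ↦ δ e (d ⊕ d′) is some δ r or vanishes, so this only tests coefficients.
    ⟦⟧-cong-shift : ∀ {q q′} → q ≈ₚ q′ → ∀ e d →
      ⟦ q ⟧ (λ d′ → δ e (d ⊕ d′)) F.≈ ⟦ q′ ⟧ (λ d′ → δ e (d ⊕ d′))
    ⟦⟧-cong-shift {q} {q′} eq e d with complement? d e
    ... | yes (r , refl) = begin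
      ⟦ q ⟧ (λ d′ → δ (d ⊕ r) (d ⊕ d′))   ≈⟨ ⟦⟧-cong q (δ-shift d r) ⟩
      ⟦ q ⟧ (δ r)                         ≈⟨ ≈ₚ⇒⟦δ⟧ {q} {q′} eq r ⟩
      ⟦ q′ ⟧ (δ r)                        ≈⟨ ⟦⟧-cong q′ (δ-shift d r) ⟨
      ⟦ q′ ⟧ (λ d′ → δ (d ⊕ r) (d ⊕ d′))  ∎
    ... | no ∄ = begin
      ⟦ q ⟧ (λ d′ → δ e (d ⊕ d′))   ≈⟨ ⟦⟧-cong q (δ-absent d ∄) ⟩
      ⟦ q ⟧ (λ _ → F.0#)            ≈⟨ F.trans (⟦⟧-zero q) (F.sym (⟦⟧-zero q′)) ⟩
      ⟦ q′ ⟧ (λ _ → F.0#)           ≈⟨ ⟦⟧-cong q′ (δ-absent d ∄) ⟨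
      ⟦ q′ ⟧ (λ d′ → δ e (d ⊕ d′))  ∎

    ⊠-comm : ∀ p q → p ⊠ q ≈ₚ q ⊠ p
    ⊠-comm p q = ⟦⟧⇒≈ₚ {p ⊠ q} {q ⊠ p} λ φ → begin
      ⟦ p ⊠ q ⟧ φ                           ≈⟨ ⟦⟧-⊠ p q φ ⟩
      ⟦ p ⟧ (λ d → ⟦ q ⟧ (λ e → φ (d ⊕ e))) ≈⟨ ⟦⟧-swap p q _ ⟩
      ⟦ q ⟧ (λ e → ⟦ p ⟧ (λ d → φ (d ⊕ e)))
        ≈⟨ ⟦⟧-cong q (λ e → ⟦⟧-cong p λ d → F.reflexive (cong φ (⊕-comm d e))) ⟩
      ⟦ q ⟧ (λ e → ⟦ p ⟧ (λ d → φ (e ⊕ d))) ≈⟨ ⟦⟧-⊠ q p φ ⟨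
      ⟦ q ⊠ p ⟧ φ                           ∎

    ⊠-assoc : ∀ p q r → (p ⊠ q) ⊠ r ≈ₚ p ⊠ (q ⊠ r)
    ⊠-assoc p q r = ⟦⟧⇒≈ₚ {(p ⊠ q) ⊠ r} {p ⊠ (q ⊠ r)} λ φ → begin
      ⟦ (p ⊠ q) ⊠ r ⟧ φ                                        ≈⟨ ⟦⟧-⊠ (p ⊠ q) r φ ⟩
      ⟦ p ⊠ q ⟧ (λ x → ⟦ r ⟧ (λ z → φ (x ⊕ z)))                ≈⟨ ⟦⟧-⊠ p q _ ⟩
      ⟦ p ⟧ (λ x → ⟦ q ⟧ (λ y → ⟦ r ⟧ (λ z → φ ((x ⊕ y) ⊕ z))))
        ≈⟨ ⟦⟧-cong p (λ x → ⟦⟧-cong q λ y → ⟦⟧-cong r λ z → F.reflexive (cong φ (⊕-assoc x y z))) ⟩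
      ⟦ p ⟧ (λ x → ⟦ q ⟧ (λ y → ⟦ r ⟧ (λ z → φ (x ⊕ (y ⊕ z)))))
        ≈⟨ ⟦⟧-cong p (λ x → ⟦⟧-⊠ q r (λ y → φ (x ⊕ y))) ⟨
      ⟦ p ⟧ (λ x → ⟦ q ⊠ r ⟧ (λ y → φ (x ⊕ y)))                ≈⟨ ⟦⟧-⊠ p (q ⊠ r) φ ⟨
      ⟦ p ⊠ (q ⊠ r) ⟧ φ                                        ∎

    -- Equal coefficients give equality only for the functionals `δ e`. That is enough, as the inner
    -- functionals of a coefficient of `p ⊠ q` are shifts of `δ e`.
    ⊠-congˡ : ∀ p {q q′} → q ≈ₚ q′ → p ⊠ q ≈ₚ p ⊠ q′
    ⊠-congˡ p {q} {q′} eq e = begin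
      coeff F n (p ⊠ q) e                       ≈⟨ coeff-⟦⟧ (p ⊠ q) e ⟩
      ⟦ p ⊠ q ⟧ (δ e)                           ≈⟨ ⟦⟧-⊠ p q (δ e) ⟩
      ⟦ p ⟧ (λ d → ⟦ q ⟧ (λ d′ → δ e (d ⊕ d′)))  ≈⟨ ⟦⟧-cong p (⟦⟧-cong-shift {q} {q′} eq e) ⟩
      ⟦ p ⟧ (λ d → ⟦ q′ ⟧ (λ d′ → δ e (d ⊕ d′))) ≈⟨ ⟦⟧-⊠ p q′ (δ e) ⟨
      ⟦ p ⊠ q′ ⟧ (δ e)                          ≈⟨ coeff-⟦⟧ (p ⊠ q′) e ⟨
      coeff F n (p ⊠ q′) e                      ∎

    ⊠-cong : ∀ {p p′ q q′} → p ≈ₚ p′ → q ≈ₚ q′ → p ⊠ q ≈ₚ p′ ⊠ q′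
    ⊠-cong {p} {p′} {q} {q′} p≈ q≈ e = begin
      coeff F n (p ⊠ q) e    ≈⟨ ⊠-congˡ p {q} {q′} q≈ e ⟩
      coeff F n (p ⊠ q′) e   ≈⟨ ⊠-comm p q′ e ⟩
      coeff F n (q′ ⊠ p) e   ≈⟨ ⊠-congˡ q′ {p} {p′} p≈ e ⟩
      coeff F n (q′ ⊠ p′) e  ≈⟨ ⊠-comm q′ p′ e ⟩
      coeff F n (p′ ⊠ q′) e  ∎

    coeff-++ : ∀ p q e → coeff F n (p ++ q) e F.≈ coeff F n p e F.+ coeff F n q e
    coeff-++ []      q e = F.sym (F.+-identityˡ _)
    coeff-++ (_ ∷ p) q e = F.trans (F.+-congˡ (coeff-++ p q e)) (F.sym (F.+-assoc _ _ _))

    ++-cong : ∀ {p p′ q q′} → p ≈ₚ p′ → q ≈ₚ q′ → p ++ q ≈ₚ p′ ++ q′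
    ++-cong {p} {p′} {q} {q′} p≈ q≈ e =
      F.trans (coeff-++ p q e) (F.trans (F.+-cong (p≈ e) (q≈ e)) (F.sym (coeff-++ p′ q′ e)))

    ++-comm : ∀ p q → p ++ q ≈ₚ q ++ p
    ++-comm p q e =
      F.trans (coeff-++ p q e) (F.trans (F.+-comm _ _) (F.sym (coeff-++ q p e)))

    ⊠-identityˡ : ∀ p → constₚ F n F.1# ⊠ p ≈ₚ p
    ⊠-identityˡ p = ⟦⟧⇒≈ₚ {constₚ F n F.1# ⊠ p} {p} λ φ → begin
      ⟦ constₚ F n F.1# ⊠ p ⟧ φ                     ≈⟨ ⟦⟧-⊠ (constₚ F n F.1#) p φ ⟩
      F.1# F.* ⟦ p ⟧ (λ e → φ (𝟎 ⊕ e)) F.+ F.0#     ≈⟨ F.+-identityʳ _ ⟩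
      F.1# F.* ⟦ p ⟧ (λ e → φ (𝟎 ⊕ e))              ≈⟨ F.*-identityˡ _ ⟩
      ⟦ p ⟧ (λ e → φ (𝟎 ⊕ e))  ≈⟨ ⟦⟧-cong p (λ e → F.reflexive (cong φ (⊕-identityˡ e))) ⟩
      ⟦ p ⟧ φ                                       ∎

    ⊠-distribʳ : ∀ r p q → (p ++ q) ⊠ r ≈ₚ (p ⊠ r) ++ (q ⊠ r)
    ⊠-distribʳ r p q = ⟦⟧⇒≈ₚ {(p ++ q) ⊠ r} {(p ⊠ r) ++ (q ⊠ r)} λ φ → begin
      ⟦ (p ++ q) ⊠ r ⟧ φ                ≈⟨ ⟦⟧-⊠ (p ++ q) r φ ⟩
      ⟦ p ++ q ⟧ (λ d → ⟦ r ⟧ (λ e → φ (d ⊕ e)))  ≈⟨ ⟦⟧-++ p q _ ⟩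
      ⟦ p ⟧ _ F.+ ⟦ q ⟧ _               ≈⟨ F.+-cong (⟦⟧-⊠ p r φ) (⟦⟧-⊠ q r φ) ⟨
      ⟦ p ⊠ r ⟧ φ F.+ ⟦ q ⊠ r ⟧ φ       ≈⟨ ⟦⟧-++ (p ⊠ r) (q ⊠ r) φ ⟨
      ⟦ (p ⊠ r) ++ (q ⊠ r) ⟧ φ          ∎

  -- Unlike ≋, which unfolds to coefficients, this lets Agda infer p and q.
  infix 4 _≋ₚ_
  record _≋ₚ_ (p q : Polynomial F n) : Set ℓ₁ where
    constructor equal
    field coeffs : _≋_ F n p q
  open _≋ₚ_ public

  polynomialSemiring : CommutativeSemiring c ℓ₁
  polynomialSemiring = record
    { Carrier = Poly
    ; _≈_ = _≋ₚ_
    ; _+_ = _+ₚ_ F n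
    ; _*_ = _*ₚ_ F n
    ; 0#  = []
    ; 1#  = constₚ F n F.1#
    ; isCommutativeSemiring = IsCommutativeSemiringˡ.isCommutativeSemiring record
      { +-isCommutativeMonoid = IsCommutativeMonoidˡ.isCommutativeMonoid record
        { isSemigroup = record
          { isMagma = record
            { isEquivalence = isEquivalence
            ; ∙-cong = λ {p} {p′} {q} {q′} (equal p≈) (equal q≈) → equal (++-cong {p} {p′} {q} {q′} p≈ q≈) }
          ; assoc = λ p q r → equal λ e → F.reflexive (cong (λ x → coeff F n x e) (++-assoc p q r)) }
        ; identityˡ = λ _ → equal λ _ → F.refl
        ; comm = λ p q → equal (++-comm p q) }
      ; *-isCommutativeMonoid = IsCommutativeMonoidˡ.isCommutativeMonoid record
        { isSemigroup = record
          { isMagma = record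
            { isEquivalence = isEquivalence
            ; ∙-cong = λ {p} {p′} {q} {q′} (equal p≈) (equal q≈) → equal (⊠-cong {p} {p′} {q} {q′} p≈ q≈) }
          ; assoc = λ p q r → equal (⊠-assoc p q r) }
        ; identityˡ = λ p → equal (⊠-identityˡ p)
        ; comm = λ p q → equal (⊠-comm p q) }
      ; distribʳ = λ r p q → equal (⊠-distribʳ r p q)
      ; zeroˡ = λ _ → equal λ _ → F.refl }
    }
    where
    isEquivalence : IsEquivalence _≋ₚ_
    isEquivalence = record
      { refl  = equal λ _ → F.refl
      ; sym   = λ (equal p≈q) → equal λ e → F.sym (p≈q e)
      ; trans = λ (equal p≈q) (equal q≈r) → equal λ e → F.trans (p≈q e) (q≈r e) }

  private
    module R = CommutativeSemiring polynomialSemiring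

  -- Degree bounds and normal forms of polynomials

  Exponents≼ : Vec ℕ n → Poly → Set c
  Exponents≼ D = All (λ (a , d) → d ≼ D)

  -- A list may contain terms that cancel, so the bound is asked of some representative; this makes
  -- it invariant under equality of coefficients.
  degreeFiltration : DegreeFiltration polynomialSemiring n
  degreeFiltration = record
    { _⊑_    = λ p D → ∃ λ q → q R.≈ p × Exponents≼ D q
    ; 1#-⊑   = constₚ F n F.1# , R.refl , ≼-refl ∷ []
    ; +-⊑    = λ {p} {q} (p′ , p′≈p , p⊑) (q′ , q′≈q , q⊑) →
        p′ ++ q′ , R.+-cong p′≈p q′≈q , All.++⁺ p⊑ q⊑
    ; *-⊑    = λ {p} {q} (p′ , p′≈p , p⊑) (q′ , q′≈q , q⊑) →
        _*ₚ_ F n p′ q′ , R.*-cong p′≈p q′≈q ,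
        All.cartesianProductWith⁺ (≡.setoid _) (≡.setoid _) (λ (a , d) (b , e) → (a F.* b , d ⊕ e)) p′ q′
          λ x∈ y∈ → ⊕-mono-≼ (All.lookup p⊑ x∈) (All.lookup q⊑ y∈)
    ; ⊑-resp = λ {p} {q} p≈q (p′ , p′≈p , p⊑) → p′ , R.trans p′≈p p≈q , p⊑
    ; ⊑-mono = λ D≼E (p′ , p′≈p , p⊑) → p′ , p′≈p , All.map (λ d≼D → ≼-trans d≼D D≼E) p⊑
    }

  open DegreeFiltration degreeFiltration using (_⊑_)
  open Expansions degreeFiltration

  coeff-⊑ : ∀ {p D} → p ⊑ D → ∀ {e} → ¬ e ≼ D → coeff F n p e F.≈ F.0#
  coeff-⊑ (q , q≈p , q⊑) {e} e⋠D = F.trans (F.sym (coeffs q≈p e)) (go q q⊑)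
    where
    go : ∀ q → Exponents≼ _ q → coeff F n q e F.≈ F.0#
    go []            []         = F.refl
    go ((a , d) ∷ q) (d≼D ∷ q⊑) with ≡-dec _≟_ d e
    ... | yes refl = contradiction d≼D e⋠D
    ... | no _     = F.trans (F.+-identityˡ _) (go q q⊑)

  module _ (φ : Vec ℕ n → F.Carrier) where
    monomials : List (Vec ℕ n) → Poly
    monomials = map λ e → (φ e , e)

    coeff-monomials-∉ : ∀ {es e} → e ∉ es → coeff F n (monomials es) e F.≈ F.0#
    coeff-monomials-∉ {[]}     {e} e∉ = F.refl
    coeff-monomials-∉ {d ∷ es} {e} e∉ with ≡-dec _≟_ d e
    ... | yes refl = contradiction (here refl) e∉
    ... | no _     = F.trans (F.+-identityˡ _) (coeff-monomials-∉ (e∉ ∘ there))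

    coeff-monomials-∈ : ∀ {es e} → Unique es → e ∈ es → coeff F n (monomials es) e F.≈ φ e
    coeff-monomials-∈ {d ∷ es} {e} (d∉ ∷ unique) e∈ with ≡-dec _≟_ d e | e∈
    ... | yes refl | _         =
      F.trans (F.+-congˡ (coeff-monomials-∉ (λ d∈ → All.lookup d∉ d∈ refl))) (F.+-identityʳ _)
    ... | no d≢e   | here refl = contradiction refl d≢e
    ... | no _     | there e∈  = F.trans (F.+-identityˡ _) (coeff-monomials-∈ unique e∈)

  -- Inside the box each exponent vector is listed exactly once, and outside it the coefficients of
  -- `p` vanish.
  normal-form : ∀ {p D} → p ⊑ D → monomials (coeff F n p) (box D) R.≈ p
  normal-form {p} {D} p⊑D = equal go
    where
    go : _≋_ F n (monomials (coeff F n p) (box D)) p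
    go e with e ≼? D
    ... | yes e≼D = coeff-monomials-∈ _ (box-unique D) (∈-box⁺ e≼D)
    ... | no e⋠D  = F.trans (coeff-monomials-∉ _ (λ e∈ → e⋠D (∈-box⁻ D e∈))) (F.sym (coeff-⊑ p⊑D e⋠D))

  -- Making a circuit binary

  weakenᵒ : ∀ {M} → Operand M → Operand (suc M)
  weakenᵒ (atom a) = atom a
  weakenᵒ (gate u) = gate (suc u)

  module _ {M} (G : Gates M) (g : Node M) where
    val-weakenᵒ : ∀ x → valᵒ (G ▸ g) (weakenᵒ x) ≡ valᵒ G x
    val-weakenᵒ (atom _) = refl
    val-weakenᵒ (gate _) = refl

    deg-weakenᵒ : ∀ x → degᵒ (G ▸ g) (weakenᵒ x) ≡ degᵒ G x
    deg-weakenᵒ (atom _) = refl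
    deg-weakenᵒ (gate _) = refl

  record Realization {N} (P : Fin N → Poly) (V : Fin N → Vec ℕ n) (M : ℕ) : Set (c ⊔ ℓ₁) where
    field
      gates   : Gates M
      operand : Fin N → Operand M
      val≡    : ∀ u → valᵒ gates (operand u) ≡ P u
      deg≡    : ∀ u → degᵒ gates (operand u) ≡ V u

  insert : ∀ {N M} {G : DAG F n N} (g : Vertex F n N) (ρ : Realization (poly F n G) (Var F n G) M) →
    let open Realization ρ in ∀ x →
    valᵒ gates x ≡ vertexPoly F n (poly F n G) g →
    degᵒ gates x ≡ vertexVar F n (Var F n G) g →
    Realization (poly F n (G ▷ g)) (Var F n (G ▷ g)) M
  insert g ρ x x≡ Dx≡ = record
    { gates   = gates
    ; operand = λ { zero → x ; (suc u) → operand u }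
    ; val≡    = λ { zero → x≡ ; (suc u) → val≡ u }
    ; deg≡    = λ { zero → Dx≡ ; (suc u) → deg≡ u } }
    where open Realization ρ

  module _ {N} {P : Fin N → Poly} {V : Fin N → Vec ℕ n}
      (node : ∀ {M} → Operand M → Operand M → Node M)
      (_∙_ : Poly → Poly → Poly) (_∘ᵥ_ : Vec ℕ n → Vec ℕ n → Vec ℕ n)
      (val-node : ∀ {M} (G : Gates M) x y →
        valⁿ G (node x y) ≡ valᵒ G x ∙ valᵒ G y)
      (deg-node : ∀ {M} (G : Gates M) x y →
        degⁿ G (node x y) ≡ degᵒ G x ∘ᵥ degᵒ G y)
      (base : Atom)
      where

      -- A gate of fan-in `r` becomes `r` binary nodes ending in the neutral element. This mirrors
      -- the `foldr` that defines its polynomial and its `Var`, so both are preserved up to `_≡_`,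
      -- and nodes correspond to edges one to one.
      chain : ∀ {M} → Realization P V M → ∀ vs →
        Σ[ ρ ∈ Realization P V (length vs + M) ] Σ[ x ∈ Operand (length vs + M) ]
          valᵒ (Realization.gates ρ) x ≡ foldr _∙_ (Atom.value base) (map P vs) ×
          degᵒ (Realization.gates ρ) x ≡ foldr _∘ᵥ_ (Atom.bound base) (map V vs)
      chain ρ []       = ρ , atom base , refl , refl
      chain ρ (v ∷ vs) with chain ρ vs
      ... | ρ′ , x , x≡ , Dx≡ = record
        { gates   = gates ▸ g
        ; operand = weakenᵒ ∘ operand
        ; val≡    = λ u → ≡.trans (val-weakenᵒ gates g (operand u)) (val≡ u)
        ; deg≡    = λ u → ≡.trans (deg-weakenᵒ gates g (operand u)) (deg≡ u) } ,
        gate zero ,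
        ≡.trans (val-node gates (operand v) x) (cong₂ _∙_ (val≡ v) x≡) ,
        ≡.trans (deg-node gates (operand v) x) (cong₂ _∘ᵥ_ (deg≡ v) Dx≡)
        where
        open Realization ρ′
        g = node (operand v) x

  private
    leafAtom : ∀ p D → All (λ (a , d) → d ≼ D) p → weight D ≤ 1 → Atom
    leafAtom p D p⊑D D≤1 = record
      { value = p ; bound = D ; value⊑ = p , R.refl , p⊑D ; weight≤1 = D≤1 }

    weight-𝟎≤1 : weight (𝟎 {n}) ≤ 1
    weight-𝟎≤1 = ℕ.≤-trans (ℕ.≤-reflexive (weight-𝟎 n)) z≤n

    zeroAtom : Atom
    zeroAtom = leafAtom [] 𝟎 [] weight-𝟎≤1

    constantAtom : F.Carrier → Atom
    constantAtom a = leafAtom (constₚ F n a) 𝟎 (≼-refl ∷ []) weight-𝟎≤1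

  binarize : ∀ {N} (G : DAG F n N) → ∃ λ M → M ≡ edges F n G × Realization (poly F n G) (Var F n G) M
  binarize [] = 0 , refl , record { gates = [] ; operand = λ () ; val≡ = λ () ; deg≡ = λ () }
  binarize (G ▷ g) with binarize G
  binarize (G ▷ var i)   | M , M≡ , ρ = M , ≡.trans M≡ (≡.sym (ℕ.+-identityʳ _)) ,
    insert (var i) ρ (atom (leafAtom (varₚ F n i) (unit i) (≼-refl ∷ []) (ℕ.≤-reflexive (weight-unit i))))
      refl refl
  binarize (G ▷ const a) | M , M≡ , ρ = M , ≡.trans M≡ (≡.sym (ℕ.+-identityʳ _)) ,
    insert (const a) ρ (atom (constantAtom a)) refl refl
  binarize (G ▷ add (v ∷ vs)) | M , refl , ρ
    with chain add (_+ₚ_ F n) _⊻_ (λ _ _ _ → refl) (λ _ _ _ → refl) zeroAtom ρ (v ∷ vs)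
  ... | ρ′ , x , x≡ , Dx≡ = _ , ℕ.+-comm (length (v ∷ vs)) M ,
    insert (add (v ∷ vs)) ρ′ x x≡ Dx≡
  binarize (G ▷ mul (v ∷ vs)) | M , refl , ρ
    with chain mul (_*ₚ_ F n) _⊕_ (λ _ _ _ → refl) (λ _ _ _ → refl) (constantAtom F.1#) ρ (v ∷ vs)
  ... | ρ′ , x , x≡ , Dx≡ = _ , ℕ.+-comm (length (v ∷ vs)) M ,
    insert (mul (v ∷ vs)) ρ′ x x≡ Dx≡

  -- Layered trees

  data Tree (l : Layer F n) : Set c
  data Child (l : Layer F n) : Set c where
    var   : Fin n → Child l
    const : F.Carrier → Child l
    tree  : ∀ {m} → _⋗_ F n l m → Tree m → Child l
  data Tree l where
    sum     : IsΣ F n l → Child l → List (Child l) → Tree l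
    product : IsΠ F n l → Child l → List (Child l) → Tree l

  treePoly   : ∀ {l} → Tree l → Poly
  childPoly  : ∀ {l} → Child l → Poly
  childPolys : ∀ {l} → List (Child l) → List Poly
  treePoly (sum _ x xs)     = foldr (_+ₚ_ F n) [] (childPoly x ∷ childPolys xs)
  treePoly (product _ x xs) = foldr (_*ₚ_ F n) (constₚ F n F.1#) (childPoly x ∷ childPolys xs)
  childPoly (var i)    = varₚ F n i
  childPoly (const a)  = constₚ F n a
  childPoly (tree _ T) = treePoly T
  childPolys []       = []
  childPolys (x ∷ xs) = childPoly x ∷ childPolys xs

  treeVar   : ∀ {l} → Tree l → Vec ℕ n
  childVar  : ∀ {l} → Child l → Vec ℕ n
  childVars : ∀ {l} → List (Child l) → List (Vec ℕ n)
  treeVar (sum _ x xs)     = foldr _⊻_ 𝟎 (childVar x ∷ childVars xs)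
  treeVar (product _ x xs) = foldr _⊕_ 𝟎 (childVar x ∷ childVars xs)
  childVar (var i)    = unit i
  childVar (const a)  = 𝟎
  childVar (tree _ T) = treeVar T
  childVars []       = []
  childVars (x ∷ xs) = childVar x ∷ childVars xs

  treeSize     : ∀ {l} → Tree l → ℕ
  childSize    : ∀ {l} → Child l → ℕ
  childrenSize : ∀ {l} → List (Child l) → ℕ
  treeSize (sum _ x xs)     = suc (length xs) + (childSize x + childrenSize xs)
  treeSize (product _ x xs) = suc (length xs) + (childSize x + childrenSize xs)
  childSize (var _)    = 0
  childSize (const _)  = 0
  childSize (tree _ T) = treeSize T
  childrenSize []       = 0
  childrenSize (x ∷ xs) = childSize x + childrenSize xs

  -- Laying out a layered tree as a graph

  module _ (k : ℕ) where
    record Stage : Set c where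
      field
        {N}        : ℕ
        graph      : DAG F n N
        layer      : Fin N → Layer F n
        wellPlaced : ∀ u → WellPlaced F n graph layer (layer u) (vertex F n graph u)
        multi-ic   : ∀ u → Vec.All (_≤ k) (Var F n graph u)
    open Stage

    -- Subtrees are appended one after another to a common graph, so the roots of finished siblings
    -- change position; `embed` tracks them, and `edges≡` keeps the exact number of new edges.
    record Extends (e : ℕ) (S S′ : Stage) : Set c where
      field
        embed  : Fin (N S) → Fin (N S′)
        poly≡  : ∀ u → poly F n (graph S′) (embed u) ≡ poly F n (graph S) u
        Var≡   : ∀ u → Var F n (graph S′) (embed u) ≡ Var F n (graph S) u
        layer≡ : ∀ u → layer S′ (embed u) ≡ layer S u
        leaf   : ∀ u → IsLeaf F n (vertex F n (graph S) u) → IsLeaf F n (vertex F n (graph S′) (embed u))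
        edges≡ : edges F n (graph S′) ≡ e + edges F n (graph S)

      input : ∀ {l u} → Input F n (graph S) (layer S) l u → Input F n (graph S′) (layer S′) l (embed u)
      input {l} {u} = Sum.map (leaf u) (subst (_⋗_ F n l) (≡.sym (layer≡ u)))
    open Extends

    extends-refl : ∀ {S} → Extends 0 S S
    extends-refl = record
      { embed = id ; poly≡ = λ _ → refl ; Var≡ = λ _ → refl ; layer≡ = λ _ → refl
      ; leaf = λ _ → id ; edges≡ = refl }

    extends-trans : ∀ {S S′ S″ d e} → Extends d S S′ → Extends e S′ S″ → Extends (e + d) S S″
    extends-trans {S} {d = d} {e} X Y = record
      { embed  = embed Y ∘ embed X
      ; poly≡  = λ u → ≡.trans (poly≡ Y (embed X u)) (poly≡ X u)
      ; Var≡   = λ u → ≡.trans (Var≡ Y (embed X u)) (Var≡ X u)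
      ; layer≡ = λ u → ≡.trans (layer≡ Y (embed X u)) (layer≡ X u)
      ; leaf   = λ u → leaf Y (embed X u) ∘ leaf X u
      ; edges≡ = ≡.trans (edges≡ Y) (≡.trans (cong (e +_) (edges≡ X)) (≡.sym (ℕ.+-assoc e d _))) }

    module _ (S : Stage) (l : Layer F n) (g : Vertex F n (N S))
             (placed : WellPlaced F n (graph S) (layer S) l g)
             (g≤k : Vec.All (_≤ k) (vertexVar F n (Var F n (graph S)) g)) where
      private
        G⁺ = graph S ▷ g

        layer⁺ : Fin (suc (N S)) → Layer F n
        layer⁺ zero    = l
        layer⁺ (suc u) = layer S u

        leaf⁺ : ∀ {g : Vertex F n (N S)} → IsLeaf F n g → IsLeaf F n (renameVertex F n suc g)
        leaf⁺ (var i)   = var i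
        leaf⁺ (const a) = const a

        placed⁺ : ∀ {m g} → WellPlaced F n (graph S) (layer S) m g →
          WellPlaced F n G⁺ layer⁺ m (renameVertex F n suc g)
        placed⁺ (var i)        = var i
        placed⁺ (const a)      = const a
        placed⁺ (add σ inputs) = add σ (All.map⁺ (All.map (Sum.map₁ leaf⁺) inputs))
        placed⁺ (mul π inputs) = mul π (All.map⁺ (All.map (Sum.map₁ leaf⁺) inputs))

      attach : Stage
      attach = record
        { graph      = G⁺
        ; layer      = layer⁺
        ; wellPlaced = λ { zero → placed⁺ placed ; (suc u) → placed⁺ (wellPlaced S u) }
        ; multi-ic   = λ { zero → g≤k ; (suc u) → multi-ic S u } }

      extends-attach : Extends (fanIn F n g) S attach
      extends-attach = record
        { embed = suc ; poly≡ = λ _ → refl ; Var≡ = λ _ → refl ; layer≡ = λ _ → refl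
        ; leaf = λ _ → leaf⁺ ; edges≡ = ℕ.+-comm _ (fanIn F n g) }

    record BuiltTree {l} (T : Tree l) (S : Stage) : Set c where
      field
        stage   : Stage
        extends : Extends (treeSize T) S stage
        root    : Fin (N stage)
        poly≡   : poly F n (graph stage) root ≡ treePoly T
        Var≡    : Var F n (graph stage) root ≡ treeVar T
        layer≡  : layer stage root ≡ l
        isSum   : IsΣ F n l → IsSum F n (vertex F n (graph stage) root)

    record BuiltChild {l} (x : Child l) (S : Stage) : Set c where
      field
        stage   : Stage
        extends : Extends (childSize x) S stage
        root    : Fin (N stage)
        poly≡   : poly F n (graph stage) root ≡ childPoly x
        Var≡    : Var F n (graph stage) root ≡ childVar x
        isInput : Input F n (graph stage) (layer stage) l root

    record BuiltChildren {l} (xs : List (Child l)) (S : Stage) : Set c where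
      field
        stage   : Stage
        extends : Extends (childrenSize xs) S stage
        roots   : List (Fin (N stage))
        polys≡  : map (poly F n (graph stage)) roots ≡ childPolys xs
        Vars≡   : map (Var F n (graph stage)) roots ≡ childVars xs
        inputs  : All (Input F n (graph stage) (layer stage) l) roots
        length≡ : length roots ≡ length xs

    built-[] : ∀ {l S} → BuiltChildren {l} [] S
    built-[] = record
      { extends = extends-refl ; roots = [] ; polys≡ = refl ; Vars≡ = refl ; inputs = [] ; length≡ = refl }

    built-∷ : ∀ {l S} {x : Child l} {xs} (B : BuiltChildren xs S) →
      BuiltChild x (BuiltChildren.stage B) → BuiltChildren (x ∷ xs) S
    built-∷ B C = record
      { extends = extends-trans B.extends C.extends
      ; roots   = C.root ∷ map (embed C.extends) B.roots
      ; polys≡  = cong₂ _∷_ C.poly≡ (≡.trans (≡.sym (map-∘ B.roots))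
          (≡.trans (map-cong (poly≡ C.extends) B.roots) B.polys≡))
      ; Vars≡   = cong₂ _∷_ C.Var≡ (≡.trans (≡.sym (map-∘ B.roots))
          (≡.trans (map-cong (Var≡ C.extends) B.roots) B.Vars≡))
      ; inputs  = C.isInput ∷ All.map⁺ (All.map (input C.extends) B.inputs)
      ; length≡ = cong suc (≡.trans (length-map _ B.roots) B.length≡) }
      where
      module B = BuiltChildren B
      module C = BuiltChild C

    fanIn+ : ∀ {S S′ S″ d e m} → e ≡ m → Extends d S S′ → Extends e S′ S″ → Extends (m + d) S S″
    fanIn+ refl = extends-trans

    built-sum : ∀ {l S x xs} (σ : IsΣ F n l) → Vec.All (_≤ k) (treeVar (sum σ x xs)) →
      BuiltChildren (x ∷ xs) S → BuiltTree (sum σ x xs) S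
    built-sum {l} σ ok record
      { stage = S′ ; extends = X ; roots = v ∷ vs
      ; polys≡ = P≡ ; Vars≡ = V≡ ; inputs = I ; length≡ = L≡ } = record
      { extends = fanIn+ L≡ X (extends-attach S′ l g placed g≤k)
      ; root    = zero
      ; poly≡   = cong (foldr (_+ₚ_ F n) []) P≡
      ; Var≡    = cong (foldr _⊻_ 𝟎) V≡
      ; layer≡  = refl
      ; isSum   = λ _ → add _ }
      where
      g = add (v ∷ vs)
      placed = add σ I
      g≤k = subst (Vec.All (_≤ k)) (≡.sym (cong (foldr _⊻_ 𝟎) V≡)) ok

    built-product : ∀ {l S x xs} (π : IsΠ F n l) → Vec.All (_≤ k) (treeVar (product π x xs)) →
      BuiltChildren (x ∷ xs) S → BuiltTree (product π x xs) S
    built-product {l} π ok record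
      { stage = S′ ; extends = X ; roots = v ∷ vs
      ; polys≡ = P≡ ; Vars≡ = V≡ ; inputs = I ; length≡ = L≡ } = record
      { extends = fanIn+ L≡ X (extends-attach S′ l g placed g≤k)
      ; root    = zero
      ; poly≡   = cong (foldr (_*ₚ_ F n) (constₚ F n F.1#)) P≡
      ; Var≡    = cong (foldr _⊕_ 𝟎) V≡
      ; layer≡  = refl
      ; isSum   = not-sum π }
      where
      g = mul (v ∷ vs)
      placed = mul π I
      g≤k = subst (Vec.All (_≤ k)) (≡.sym (cong (foldr _⊕_ 𝟎) V≡)) ok
      not-sum : ∀ {l} {A : Set c} → IsΠ F n l → IsΣ F n l → A
      not-sum upperΠ ()
      not-sum bottomΠ ()

    built-leaf : ∀ {l S} (x : Child l) (g : Vertex F n (N S)) → IsLeaf F n (renameVertex F n suc g) →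
      WellPlaced F n (graph S) (layer S) l g → Vec.All (_≤ k) (childVar x) → childSize x ≡ fanIn F n g →
      vertexPoly F n (poly F n (graph S)) g ≡ childPoly x → vertexVar F n (Var F n (graph S)) g ≡ childVar x →
      BuiltChild x S
    built-leaf {l} {S} x g isLeaf placed ok size≡ p≡ V≡ = record
      { stage   = attach S l g placed g≤k
      ; extends = subst (λ e → Extends e S (attach S l g placed g≤k)) (≡.sym size≡)
          (extends-attach S l g placed g≤k)
      ; root    = zero
      ; poly≡   = p≡
      ; Var≡    = V≡
      ; isInput = inj₁ isLeaf }
      where g≤k = subst (Vec.All (_≤ k)) (≡.sym V≡) ok

    build         : ∀ {l} (T : Tree l) S → Vec.All (_≤ k) (treeVar T) → BuiltTree T S
    buildChild    : ∀ {l} (x : Child l) S → Vec.All (_≤ k) (childVar x) → BuiltChild x S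
    buildChildren : ∀ {l} (xs : List (Child l)) S → All (Vec.All (_≤ k)) (childVars xs) → BuiltChildren xs S
    build (sum σ x xs) S ok with summand≼⨆ (childVar x ∷ childVars xs) ok
    ... | ok₁ ∷ oks = built-sum σ ok (built-∷ B (buildChild x _ ok₁))
      where B = buildChildren xs S oks
    build (product π x xs) S ok with summand≼⨁ (childVar x ∷ childVars xs) ok
    ... | ok₁ ∷ oks = built-product π ok (built-∷ B (buildChild x _ ok₁))
      where B = buildChildren xs S oks
    buildChild (var i)    S ok = built-leaf (var i) (var i) (var i) (var i) ok refl refl refl
    buildChild (const a)  S ok = built-leaf (const a) (const a) (const a) (const a) ok refl refl refl
    buildChild {l} (tree l⋗m T) S ok = record
      { extends = B.extends ; root = B.root ; poly≡ = B.poly≡ ; Var≡ = B.Var≡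
      ; isInput = inj₂ (subst (_⋗_ F n l) (≡.sym B.layer≡) l⋗m) }
      where module B = BuiltTree (build T S ok)
    buildChildren []       S []          = built-[]
    buildChildren (x ∷ xs) S (ok₁ ∷ oks) = built-∷ B (buildChild x _ ok₁)
      where B = buildChildren xs S oks

  circuitOf : ∀ {k} (T : Tree topΣ) → Vec.All (_≤ k) (treeVar T) →
    Σ[ C ∈ Circuit F n ] IsΣΠΣΠ F n C × Multi-ic F n k C × size F n C ≡ treeSize T × computed F n C ≡ treePoly T
  circuitOf {k} T ok = circuit (Stage.graph stage) root ,
    record { layer = Stage.layer stage ; wellPlaced = Stage.wellPlaced stage
           ; outputSum = isSum topΣ ; outputTop = layer≡ } ,
    Stage.multi-ic stage ,
    ≡.trans (Extends.edges≡ extends) (ℕ.+-identityʳ _) ,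
    poly≡
    where
    empty : Stage k
    empty = record { graph = [] ; layer = λ () ; wellPlaced = λ () ; multi-ic = λ () }
    open BuiltTree (build k T empty ok)

  -- The depth-4 tree of an expansion

  node-size : ∀ {l} (xs : List (Child l)) {b} → All (λ x → childSize x ≤ b) xs →
    suc (length xs) + childrenSize xs ≤ level (length xs) b
  node-size xs {b} xs≤b = s≤s (ℕ.≤-trans (ℕ.+-monoʳ-≤ (length xs) (go xs xs≤b))
    (ℕ.≤-reflexive (≡.sym (ℕ.*-suc (length xs) b))))
    where
    go : ∀ xs → All (λ x → childSize x ≤ b) xs → childrenSize xs ≤ length xs * b
    go []       []           = z≤n
    go (x ∷ xs) (x≤ ∷ xs≤b) = ℕ.+-mono-≤ x≤ (go xs xs≤b)

  mapped-size : ∀ {a} {A : Set a} {l} (f : A → Child l) xs {b L} →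
    All (λ x → childSize (f x) ≤ b) xs → length xs ≤ L →
    suc (length (map f xs)) + childrenSize (map f xs) ≤ level L b
  mapped-size f xs xs≤b ≤L = ℕ.≤-trans (node-size (map f xs) (All.map⁺ xs≤b))
    (level-mono (ℕ.≤-trans (ℕ.≤-reflexive (length-map f xs)) ≤L) ℕ.≤-refl)

  ⨆-mapped : ∀ {a} {A : Set a} {l} (f : A → Child l) {D} xs →
    All (λ x → childVar (f x) ≼ D) xs → foldr _⊻_ 𝟎 (childVars (map f xs)) ≼ D
  ⨆-mapped f []       []           = 𝟎≼ _
  ⨆-mapped f (x ∷ xs) (x≼ ∷ xs≼D) = ⊻-lub x≼ (⨆-mapped f xs xs≼D)

  const-0# : constₚ F n F.0# R.≈ []
  const-0# = equal go
    where
    go : _≋_ F n (constₚ F n F.0#) []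
    go e with ≡-dec _≟_ 𝟎 e
    ... | yes _ = F.+-identityˡ _
    ... | no _  = F.+-identityˡ _

  monomial-cong : ∀ {a b d} → a F.≈ b → ((a , d) ∷ []) R.≈ ((b , d) ∷ [])
  monomial-cong {a} {b} {d} a≈b = equal go
    where
    go : _≋_ F n ((a , d) ∷ []) ((b , d) ∷ [])
    go e with ≡-dec _≟_ d e
    ... | yes _ = F.+-congʳ a≈b
    ... | no _  = F.refl

  monomialTree : F.Carrier → Vec ℕ n → Tree bottomΠ
  monomialTree a e = product bottomΠ (const a) (map var (variables e))

  monomialTree-poly : ∀ a e → treePoly (monomialTree a e) R.≈ ((a , e) ∷ [])
  monomialTree-poly a e = R.trans (R.*-congˡ {constₚ F n a} (go is))
    (subst (λ d → ((a F.* F.1# , d) ∷ []) R.≈ ((a , e) ∷ []))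
      (≡.sym (≡.trans (⊕-identityˡ _) (degrees-variables e))) (monomial-cong (F.*-identityʳ a)))
    where
    is = variables e
    go : ∀ is → foldr (_*ₚ_ F n) (constₚ F n F.1#) (childPolys (map (var {l = bottomΠ}) is))
      R.≈ ((F.1# , degrees is) ∷ [])
    go []       = R.refl
    go (i ∷ is) = R.trans (R.*-congˡ {varₚ F n i} (go is)) (monomial-cong (F.*-identityˡ F.1#))

  monomialTree-var : ∀ a e → treeVar (monomialTree a e) ≡ e
  monomialTree-var a e = ≡.trans (⊕-identityˡ _)
    (≡.trans (cong (foldr _⊕_ 𝟎) (go (variables e))) (degrees-variables e))
    where
    go : ∀ is → childVars (map (var {l = bottomΠ}) is) ≡ map unit is
    go []       = refl
    go (i ∷ is) = cong (unit i ∷_) (go is)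

  monomialTree-size : ∀ a e → treeSize (monomialTree a e) ≡ suc (weight e)
  monomialTree-size a e = cong suc (≡.trans (cong₂ _+_
    (≡.trans (length-map var (variables e)) (length-variables e)) (go (variables e))) (ℕ.+-identityʳ _))
    where
    go : ∀ is → childrenSize (map (var {l = bottomΠ}) is) ≡ 0
    go []       = refl
    go (i ∷ is) = go is

  module _ (t : ℕ) where
    open Piece

    module _ (P : Piece t) where
      private
        monomial : Vec ℕ n → Child lowerΣ
        monomial e = tree lowerΣ⋗bottomΠ (monomialTree (coeff F n (value P) e) e)

      pieceTree : Tree lowerΣ
      pieceTree = sum lowerΣ (const F.0#) (map monomial (box (bound P)))

      pieceTree-poly : treePoly pieceTree R.≈ value P
      pieceTree-poly = R.trans (R.+-cong const-0# (go (box (bound P))))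
        (normal-form {value P} (value⊑ P))
        where
        go : ∀ es → foldr (_+ₚ_ F n) [] (childPolys (map monomial es)) R.≈ monomials (coeff F n (value P)) es
        go []       = R.refl
        go (e ∷ es) = R.+-cong (monomialTree-poly _ e) (go es)

      pieceTree-var : treeVar pieceTree ≼ bound P
      pieceTree-var = ⊻-lub (𝟎≼ _) (⨆-mapped monomial (box (bound P)) (All.tabulate λ {e} e∈ →
        ≼-trans (≼-reflexive (monomialTree-var (coeff F n (value P) e) e)) (∈-box⁻ (bound P) e∈)))

      pieceTree-size : treeSize pieceTree ≤ level (2 ^ t) (suc t)
      pieceTree-size = mapped-size monomial (box (bound P)) (All.tabulate λ {e} e∈ →
          ℕ.≤-trans (ℕ.≤-reflexive (monomialTree-size (coeff F n (value P) e) e))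
            (s≤s (ℕ.≤-trans (weight-mono (∈-box⁻ (bound P) e∈)) (weight≤t P))))
        (ℕ.≤-trans (length-box (bound P)) (ℕ.^-monoʳ-≤ 2 (weight≤t P)))

    private
      factor : Piece t → Child upperΠ
      factor P = tree upperΠ⋗lowerΣ (pieceTree P)

    summandTree : List (Piece t) → Tree upperΠ
    summandTree Ps = product upperΠ (const F.1#) (map factor Ps)

    summandTree-poly : ∀ Ps → treePoly (summandTree Ps) R.≈ ∏ t Ps
    summandTree-poly Ps = R.trans
      (R.*-identityˡ (foldr (_*ₚ_ F n) (constₚ F n F.1#) (childPolys (map factor Ps)))) (go Ps)
      where
      go : ∀ Ps → foldr (_*ₚ_ F n) (constₚ F n F.1#) (childPolys (map factor Ps)) R.≈ ∏ t Ps
      go []       = R.refl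
      go (P ∷ Ps) = R.*-cong
        (pieceTree-poly P) (go Ps)

    summandTree-var : ∀ Ps → treeVar (summandTree Ps) ≼ ⨁ t Ps
    summandTree-var Ps = ≼-trans (≼-reflexive (⊕-identityˡ _)) (go Ps)
      where
      go : ∀ Ps → foldr _⊕_ 𝟎 (childVars (map factor Ps)) ≼ ⨁ t Ps
      go []       = ≼-refl
      go (P ∷ Ps) = ⊕-mono-≼ (pieceTree-var P) (go Ps)

    summandTree-size : ∀ Ps {N} → length Ps ≤ N → treeSize (summandTree Ps) ≤ level N (level (2 ^ t) (suc t))
    summandTree-size Ps = mapped-size factor Ps (All.universal pieceTree-size Ps)

    private
      summand : List (Piece t) → Child topΣ
      summand Ps = tree topΣ⋗upperΠ (summandTree Ps)

    -- Gates need at least one child, but an expansion may have no summands. A leaf with the neutral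
    -- constant, here and in `pieceTree` and `summandTree`, covers the empty case at the cost of one
    -- edge per gate.
    expansionTree : List (List (Piece t)) → Tree topΣ
    expansionTree Pss = sum topΣ (const F.0#) (map summand Pss)

    expansionTree-poly : ∀ Pss → treePoly (expansionTree Pss) R.≈ ∑∏ t Pss
    expansionTree-poly Pss = R.+-cong const-0# (go Pss)
      where
      go : ∀ Pss → foldr (_+ₚ_ F n) [] (childPolys (map summand Pss)) R.≈ ∑∏ t Pss
      go []         = R.refl
      go (Ps ∷ Pss) = R.+-cong
        (summandTree-poly Ps) (go Pss)

    module _ {p D A N} (X : Expansion t p D A N) where
      open Expansion X

      expansion-var : treeVar (expansionTree terms) ≼ D
      expansion-var = ⊻-lub (𝟎≼ _) (⨆-mapped summand terms (All.map (λ {Ps} → ≼-trans (summandTree-var Ps)) bounded))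

      expansion-size : treeSize (expansionTree terms) ≤ level A (level N (level (2 ^ t) (suc t)))
      expansion-size = mapped-size summand terms (All.map (λ {Ps} → summandTree-size Ps) factors≤) length≤

      expansion-poly : treePoly (expansionTree terms) R.≈ p
      expansion-poly = R.trans (expansionTree-poly terms) correct

-- Choice of parameters and the size estimate

-- An upward search with fuel `d`: once `i` reaches `x`, the growth of `f` forces `x < f (suc i)`.
-- It yields rounded-down logarithms and square roots alike, and starting at 1 makes them positive.
bracket : ∀ (f : ℕ → ℕ) → (∀ i → i < f (suc i)) → ∀ d i {x} → x ≤ d + i → f i ≤ x →
  ∃ λ j → i ≤ j × f j ≤ x × x < f (suc j)
bracket f grows d i {x} x≤d+i fi≤x with x <? f (suc i)
bracket f grows d       i x≤d+i fi≤x | yes x<f = i , ℕ.≤-refl , fi≤x , x<f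
bracket f grows zero    i x≤i   fi≤x | no x≮f  = contradiction (ℕ.≤-<-trans x≤i (grows i)) x≮f
bracket f grows (suc d) i x≤d+i fi≤x | no x≮f
  with bracket f grows d (suc i) (ℕ.≤-trans x≤d+i (ℕ.≤-reflexive (≡.sym (ℕ.+-suc d i)))) (ℕ.≮⇒≥ x≮f)
... | j , i<j , lower , upper = j , ℕ.<⇒≤ i<j , lower , upper

⌊log⌋ : ∀ {s} → 2 ≤ s → ∃ λ L → 1 ≤ L × 2 ^ L ≤ s × s < 2 ^ suc L
⌊log⌋ {s} 2≤s = bracket (2 ^_) (λ i → ℕ.≤-trans (ℕ.n≤1+n _) (suc≤2^ (suc i))) s 1 (ℕ.m≤m+n s 1) 2≤s

⌊√⌋ : ∀ {x} → 1 ≤ x → ∃ λ t → 1 ≤ t × t * t ≤ x × x < suc t * suc t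
⌊√⌋ {x} 1≤x = bracket (λ i → i * i) (λ i → ℕ.m≤m+n (suc i) _) x 1 (ℕ.m≤m+n x 1) 1≤x

^-cancelˡ-≤ : ∀ {x y} → 2 ^ x ≤ 2 ^ y → x ≤ y
^-cancelˡ-≤ {x} {y} le with x ≤? y
... | yes x≤y = x≤y
... | no x≰y  = contradiction le (ℕ.<⇒≱ (ℕ.^-monoʳ-< 2 ℕ.≤-refl (ℕ.≰⇒> x≰y)))

square-cancel-≤ : ∀ {x y} → x * x ≤ y * y → x ≤ y
square-cancel-≤ {x} {y} le with x ≤? y
... | yes x≤y = x≤y
... | no x≰y  = contradiction le (ℕ.<⇒≱ (ℕ.*-mono-< (ℕ.≰⇒> x≰y) (ℕ.≰⇒> x≰y)))

level-2^ : ∀ {L b} x y → L ≤ 2 ^ x → b ≤ 2 ^ y → level L b ≤ 2 ^ (2 + (x + y))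
level-2^ {L} {b} x y L≤ b≤ = begin
  suc (L * suc b)                   ≤⟨ s≤s (ℕ.*-mono-≤ L≤
                                         (ℕ.≤-trans (s≤s b≤) (ℕ.+-monoˡ-≤ (2 ^ y) (ℕ.m^n>0 2 y)))) ⟩
  suc (2 ^ x * (2 ^ y + 2 ^ y))     ≤⟨ ℕ.+-monoˡ-≤ _ (ℕ.*-mono-≤ (ℕ.m^n>0 2 x)
                                         (ℕ.≤-trans (ℕ.m^n>0 2 y) (ℕ.m≤m+n _ _))) ⟩
  2 ^ x * (2 ^ y + 2 ^ y) + 2 ^ x * (2 ^ y + 2 ^ y)  ≡⟨ collect (2 ^ x) (2 ^ y) ⟩
  2 * (2 * (2 ^ x * 2 ^ y))         ≡⟨ cong (λ z → 2 * (2 * z)) (ℕ.^-distribˡ-+-* 2 x y) ⟨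
  2 ^ (2 + (x + y))                 ∎
  where
  open ℕ.≤-Reasoning
  collect : ∀ a b → a * (b + b) + a * (b + b) ≡ 2 * (2 * (a * b))
  collect = solve-∀

module _ {m s L t : ℕ} .{{_ : NonZero t}} (1≤L : 1 ≤ L) (1≤t : 1 ≤ t) (2^L≤s : 2 ^ L ≤ s) (s<2^ : s < 2 ^ suc L)
         (t²≤mL : t * t ≤ m * L) (mL<t² : m * L < suc t * suc t) where
  private
    instance
      L≢0 : NonZero L
      L≢0 = >-nonZero 1≤L

  -- The balance of the two costs: the budget is at most `2 * m / t`, and `m * L` is less than
  -- `(t + 1)²`, hence at most `4 * t²`. So the logarithm of the number of summands is also of order
  -- `t`.
  budget*L≤8t : ∀ {w} → w ≤ m → budget t w * L ≤ 8 * t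
  budget*L≤8t {w} w≤m = ℕ.*-cancelʳ-≤ (budget t w * L) (8 * t) t (begin
    budget t w * L * t          ≡⟨ swap (budget t w) L t ⟩
    budget t w * t * L          ≤⟨ ℕ.*-monoˡ-≤ L (ℕ.≤-trans (budget*t≤slack t w)
                                     (ℕ.≤-trans (slack≤ t w) (ℕ.*-monoʳ-≤ 2 w≤m))) ⟩
    2 * m * L                   ≡⟨ ℕ.*-assoc 2 m L ⟩
    2 * (m * L)                 ≤⟨ ℕ.*-monoʳ-≤ 2 (ℕ.<⇒≤ mL<t²) ⟩
    2 * (suc t * suc t)         ≤⟨ ℕ.*-monoʳ-≤ 2 (ℕ.*-mono-≤ 1+t≤2t 1+t≤2t) ⟩
    2 * ((t + t) * (t + t))     ≡⟨ collect t ⟩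
    8 * t * t                   ∎)
    where
    open ℕ.≤-Reasoning
    1+t≤2t : suc t ≤ t + t
    1+t≤2t = ℕ.+-monoˡ-≤ t 1≤t
    swap : ∀ e L t → e * L * t ≡ e * t * L
    swap = solve-∀
    collect : ∀ t → 2 * ((t + t) * (t + t)) ≡ 8 * t * t
    collect = solve-∀

  size-bound : ∀ {w} → w ≤ m → let e = budget t w in
    level ((s + s) ^ e) (level (suc (2 * e)) (level (2 ^ t) (suc t))) ≤ 2 ^ (48 * t)
  size-bound {w} w≤m = ℕ.≤-trans
    (level-2^ ((2 + L) * e) (2 + (2 * e + (2 + (t + t)))) summands
      (level-2^ (2 * e) (2 + (t + t)) (suc≤2^ (2 * e)) (level-2^ t t ℕ.≤-refl (suc≤2^ t))))
    (ℕ.^-monoʳ-≤ 2 exponent)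
    where
    open ℕ.≤-Reasoning
    e = budget t w
    eL≤8t = budget*L≤8t w≤m
    summands : (s + s) ^ e ≤ 2 ^ ((2 + L) * e)
    summands = ℕ.≤-trans
      (ℕ.^-monoˡ-≤ e (ℕ.+-mono-≤ (ℕ.<⇒≤ s<2^) (ℕ.≤-trans (ℕ.<⇒≤ s<2^) (ℕ.m≤m+n (2 ^ suc L) 0))))
      (ℕ.≤-reflexive (ℕ.^-*-assoc 2 (2 + L) e))
    exponent : 2 + ((2 + L) * e + (2 + (2 * e + (2 + (t + t))))) ≤ 48 * t
    exponent = begin
      2 + ((2 + L) * e + (2 + (2 * e + (2 + (t + t)))))  ≡⟨ collect L e t ⟩
      -- The 6 collects the 2 lost at each of three levels. As `1 ≤ L`, both `e` and `e * L` are at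
      -- most `8 * t`.
      6 * 1 + 4 * e + e * L + 2 * t    ≤⟨ ℕ.+-monoˡ-≤ (2 * t) (ℕ.+-mono-≤ (ℕ.+-mono-≤ (ℕ.*-monoʳ-≤ 6 1≤t)
                                           (ℕ.*-monoʳ-≤ 4 (ℕ.≤-trans (ℕ.m≤m*n e L) eL≤8t))) eL≤8t) ⟩
      6 * t + 4 * (8 * t) + 8 * t + 2 * t    ≡⟨ total t ⟩
      48 * t                           ∎
      where
      collect : ∀ L e t → 2 + ((2 + L) * e + (2 + (2 * e + (2 + (t + t))))) ≡ 6 * 1 + 4 * e + e * L + 2 * t
      collect = solve-∀
      total : ∀ t → 6 * t + 4 * (8 * t) + 8 * t + 2 * t ≡ 48 * t
      total = solve-∀

  -- Only the integer `L` is available in place of the logarithm of `s`: the hypothesis on `p` and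
  -- `q` is read with `s < 2 ^ suc L`, the conclusion with `2 ^ L ≤ s`. Doubling the constant
  -- absorbs this gap.
  power-bound-2^ : ∀ {S} k → S ≤ 2 ^ (k * t) → Power≤ S s (2 * k) m
  power-bound-2^ {S} k S≤ p q 1≤q exponent≤ = begin
    S ^ q               ≤⟨ ℕ.^-monoˡ-≤ q S≤ ⟩
    (2 ^ (k * t)) ^ q   ≡⟨ ℕ.^-*-assoc 2 (k * t) q ⟩
    2 ^ (k * t * q)     ≤⟨ ℕ.^-monoʳ-≤ 2 ktq≤Lp ⟩
    2 ^ (L * p)         ≡⟨ ℕ.^-*-assoc 2 L p ⟨
    (2 ^ L) ^ p         ≤⟨ ℕ.^-monoˡ-≤ p 2^L≤s ⟩
    s ^ p               ∎
    where
    open ℕ.≤-Reasoning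
    exponents : 2 * k * (2 * k) * m * (q * q) ≤ suc L * (p * p)
    exponents = ^-cancelˡ-≤ (ℕ.≤-trans exponent≤ (ℕ.≤-trans (ℕ.^-monoˡ-≤ (p * p) (ℕ.<⇒≤ s<2^))
      (ℕ.≤-reflexive (ℕ.^-*-assoc 2 (suc L) (p * p)))))
    squares : (2 * (k * t * q)) * (2 * (k * t * q)) ≤ (2 * (L * p)) * (2 * (L * p))
    squares = begin
      (2 * (k * t * q)) * (2 * (k * t * q))      ≡⟨ regroup k t q ⟩
      (2 * k * (2 * k) * (q * q)) * (t * t)      ≤⟨ ℕ.*-monoʳ-≤ (2 * k * (2 * k) * (q * q)) t²≤mL ⟩
      (2 * k * (2 * k) * (q * q)) * (m * L)      ≡⟨ regroup′ (2 * k * (2 * k)) (q * q) m L ⟩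
      2 * k * (2 * k) * m * (q * q) * L          ≤⟨ ℕ.*-monoˡ-≤ L exponents ⟩
      -- Estimating `suc L` by `4 * L` leaves a perfect square on the right, so the root can be
      -- taken in the integers.
      suc L * (p * p) * L                 ≤⟨ ℕ.*-monoˡ-≤ L (ℕ.*-monoˡ-≤ (p * p)
                                             (ℕ.+-mono-≤ 1≤L (ℕ.m≤m+n L (2 * L)))) ⟩
      (L + (L + 2 * L)) * (p * p) * L     ≡⟨ regroup″ L p ⟩
      (2 * (L * p)) * (2 * (L * p))       ∎
      where
      regroup : ∀ k t q → (2 * (k * t * q)) * (2 * (k * t * q)) ≡ (2 * k * (2 * k) * (q * q)) * (t * t)
      regroup = solve-∀
      regroup′ : ∀ k q m L → k * q * (m * L) ≡ k * m * q * L
      regroup′ = solve-∀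
      regroup″ : ∀ L p → (L + (L + 2 * L)) * (p * p) * L ≡ (2 * (L * p)) * (2 * (L * p))
      regroup″ = solve-∀
    ktq≤Lp : k * t * q ≤ L * p
    ktq≤Lp = ℕ.*-cancelˡ-≤ 2 (square-cancel-≤ squares)

  power-bound : ∀ {S w} → w ≤ m → let e = budget t w in
    S ≤ level ((s + s) ^ e) (level (suc (2 * e)) (level (2 ^ t) (suc t))) → Power≤ S s 96 m
  power-bound w≤m S≤ = power-bound-2^ 48 (ℕ.≤-trans S≤ (size-bound w≤m))

-- Depth reduction

module _ {c ℓ₁ ℓ₂} (F : HeytingField c ℓ₁ ℓ₂) (n k : ℕ) (1≤n : 1 ≤ n) (1≤k : 1 ≤ k) where
  open Expansions (degreeFiltration F n)

  depth-reduction : (C : Circuit F n) → 2 ≤ size F n C → Multi-ic F n k C →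
    Σ[ C′ ∈ Circuit F n ]
      IsΣΠΣΠ F n C′ ×
      Multi-ic F n k C′ ×
      Power≤ (size F n C′) (size F n C) 96 (k * n) ×
      _≋_ F n (computed F n C′) (computed F n C)
  depth-reduction (circuit G o) 2≤s multi-ic
    with ⌊log⌋ 2≤s
  -- `t` is the integer part of the square root of `k * n * L`; it is positive because all three
  -- factors are.
  ... | L , 1≤L , 2^L≤s , s<2^ with ⌊√⌋ (ℕ.*-mono-≤ (ℕ.*-mono-≤ 1≤k 1≤n) 1≤L)
  ... | t , 1≤t , t²≤mL , mL<t² with binarize F n G
  ... | M , M≡s , ρ =
    let C′ , isΣΠΣΠ , multi-ic′ , size≡ , computed≡ =
          circuitOf F n (expansionTree F n t (Expansion.terms X)) (All-≼ (expansion-var F n t X) V≤k)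
    in C′ , isΣΠΣΠ , multi-ic′ ,
      power-bound 1≤L 1≤t 2^L≤s s<2^ t²≤mL mL<t² (weight-bounded V≤k)
        (ℕ.≤-trans (ℕ.≤-reflexive size≡) (expansion-size F n t X)) ,
      coeffs (subst₂ (_≋ₚ_ F n) (≡.sym computed≡) (val≡ o) (expansion-poly F n t X))
    where
    open Realization ρ
    instance
      t≢0 : NonZero t
      t≢0 = >-nonZero 1≤t
    X = expand t 1≤t (edges F n G) M ℕ.≤-refl (ℕ.≤-reflexive M≡s) gates (operand o)
    V≤k = subst (Vec.All (_≤ k)) (≡.sym (deg≡ o)) (multi-ic o)

theorem1p7 : ∃ω {ℕ} λ K →
    ∀ {c ℓ₁ ℓ₂} (F : HeytingField c ℓ₁ ℓ₂) (n k s : ℕ) →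
    1 ≤ n → 1 ≤ k → 2 ≤ s →
    (C : Circuit F n) → Multi-ic F n k C → size F n C ≡ s →
    Σ[ C′ ∈ Circuit F n ]
    IsΣΠΣΠ F n C′ ×
    Multi-ic F n k C′ ×
    Power≤ (size F n C′) s K (k * n) ×
    _≋_ F n (computed F n C′) (computed F n C)
-- `96` is the exponent constant 48 of `size-bound`, doubled by `power-bound-2^`.
theorem1p7 = 96 ,ω λ { F n k _ 1≤n 1≤k 2≤s C multi-ic refl →
  depth-reduction F n k 1≤n 1≤k C 2≤s multi-ic }
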